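{- Over an alphabet with as many characters as needed, the smallest bidirectional scheme size $b$ satisfies: (substitutions) $\mathsf{AS}_{\mathrm{sub}}(b,n)\ge b/2-1$ and $\mathsf{AS}_{\mathrm{sub}}(b,n)=\Omega(\sqrt n)$, i.e. there is a constant $c>0$ and strings $T$ of arbitrarily large length $n$ with $b(T)$ arbitrarily large, each with a string $T'$ of length $n$, $\mathsf{ed}(T,T')=1$, such that $b(T')-b(T)\ge b(T)/2-1$ and $b(T')-b(T)\ge c\sqrt n$; (insertions) $\mathsf{AS}_{\mathrm{ins}}(b,n)\ge b/2-1$ and $\mathsf{AS}_{\mathrm{ins}}(b,n)=\Omega(\sqrt n)$ (same sense, $|T'|=n+1$); (deletions) $\liminf_{n\to\infty}\mathsf{MS}_{\mathrm{del}}(b,n)\ge 1.5$, $\mathsf{AS}_{\mathrm{del}}(b,n)\ge b/2-3$ and $\mathsf{AS}_{\mathrm{del}}(b,n)=\Omega(\sqrt n)$ (same sense, $|T'|=n-1$).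
   Context: A bidirectional scheme of a string $T$ of length $n$ is a factorization $T=f_1\cdots f_m$ into phrases $f_j=T[p_j..p_j+\ell_j-1]$, where each phrase is either a single character (a ground phrase) or is assigned a source $q_j\neq p_j$ with $T[q_j..q_j+\ell_j-1]=f_j$. It defines $F:[0..n]\to[0..n]$ by $F(p_j)=0$ for a ground phrase, $F(p_j+k)=q_j+k$ for $0\le k<\ell_j$ for a non-ground phrase, and $F(0)=0$. The scheme is valid if for every $x\in[1..n]$ some iterate $F^m(x)$ equals $0$. $b(T)$ is the minimum number of phrases of a valid bidirectional scheme of $T$. $\mathsf{ed}$ is edit distance; $\mathsf{MS}_{\mathrm{sub}}(C,n)=\sup\{C(T')/C(T):T\in\Sigma^n,T'\in\Sigma^n,\mathsf{ed}(T,T')=1\}$, with $T'\in\Sigma^{n+1}$ (ins) or $\Sigma^{n-1}$ (del); $\mathsf{AS}$ analogously with differences. -}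

module Defs where

open import Data.Nat using (ℕ; zero; suc; _+_; _*_; _∸_; _^_; _≤_; _<_; _⊓_; _≡ᵇ_; _<ᵇ_; _≤ᵇ_)
open import Data.Bool using (Bool; true; false; if_then_else_; _∧_)
open import Data.List using (List; []; _∷_; length; take; drop; map)
open import Data.Nat.ListAction using (sum)
open import Data.Product using (Σ; _×_; ∃)
open import Data.Unit using (⊤)
open import Relation.Binary.PropositionalEquality using (_≡_; _≢_)

-- Strings over the (unbounded) alphabet ℕ; positions are 1-indexed as in the paper.
Str : Set
Str = List ℕ

ed : Str → Str → ℕ
ed [] ys = length ys
ed (x ∷ xs) [] = suc (length xs)
ed (x ∷ xs) (y ∷ ys) =
  (ed xs ys + (if x ≡ᵇ y then 0 else 1)) ⊓ suc (ed xs (y ∷ ys) ⊓ ed (x ∷ xs) ys)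

data Phrase : Set where
  ground : Phrase
  copy   : (ℓ q : ℕ) → Phrase

len : Phrase → ℕ
len ground = 1
len (copy ℓ q) = ℓ

-- T[p..p+ℓ-1] (1-indexed)
substr : Str → ℕ → ℕ → Str
substr T p ℓ = take ℓ (drop (p ∸ 1) T)

PhraseOK : Str → ℕ → Phrase → Set
PhraseOK T p ground = ⊤
PhraseOK T p (copy ℓ q) =
  1 ≤ ℓ × 1 ≤ q × q + ℓ ∸ 1 ≤ length T × q ≢ p × substr T q ℓ ≡ substr T p ℓ

PhrasesOK : Str → ℕ → List Phrase → Set
PhrasesOK T p [] = ⊤
PhrasesOK T p (f ∷ fs) = PhraseOK T p f × PhrasesOK T (p + len f) fs

-- the function F of the scheme, phrases starting at position p; F(0)=0
Fat : ℕ → List Phrase → ℕ → ℕ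
Fat p [] x = 0
Fat p (ground ∷ fs) x = if x ≡ᵇ p then 0 else Fat (suc p) fs x
Fat p (copy ℓ q ∷ fs) x =
  if (p ≤ᵇ x) ∧ (x <ᵇ p + ℓ) then q + (x ∸ p) else Fat (p + ℓ) fs x

F : List Phrase → ℕ → ℕ
F fs = Fat 1 fs

iter : (ℕ → ℕ) → ℕ → ℕ → ℕ
iter f zero x = x
iter f (suc m) x = f (iter f m x)

ValidScheme : Str → List Phrase → Set
ValidScheme T fs =
  sum (map len fs) ≡ length T ×
  PhrasesOK T 1 fs ×
  (∀ x → 1 ≤ x → x ≤ length T → ∃ λ m → iter (F fs) m x ≡ 0)

IsB : Str → ℕ → Set
IsB T k =
  (Σ (List Phrase) λ fs → ValidScheme T fs × length fs ≡ k) ×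
  (∀ fs → ValidScheme T fs → k ≤ length fs)

-- Additive-sensitivity lower bound for one edit type:
-- lenT' n = required length of T' (n, n+1, n-1); slack s encodes
-- b(T') - b(T) ≥ b(T)/2 - s/2, i.e. 3 b(T) ≤ 2 b(T') + s;
-- constant c = 1/d: c·√n ≤ b(T') - b(T)  ⇔  n ≤ (d·(b(T') - b(T)))².
ASLowerBound : (ℕ → ℕ) → ℕ → Set
ASLowerBound lenT' s =
  Σ ℕ λ d → ∀ N →
    Σ Str λ T → Σ Str λ T' → Σ ℕ λ bT → Σ ℕ λ bT' →
      N ≤ length T × N ≤ bT ×
      length T' ≡ lenT' (length T) × ed T T' ≡ 1 ×
      IsB T bT × IsB T' bT' ×
      3 * bT ≤ 2 * bT' + s ×
      length T ≤ (d * (bT' ∸ bT)) ^ 2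

-- liminf_{n→∞} MS_del(b,n) ≥ 3/2 :
-- for every k ≥ 1 there is N such that for all n ≥ N some T of length n and
-- deletion T' (length n-1, ed 1) have b(T')/b(T) > 3/2 - 1/k.
LiminfMSDel : Set
LiminfMSDel =
  ∀ k → 1 ≤ k → Σ ℕ λ N → ∀ n → N ≤ n →
    Σ Str λ T → Σ Str λ T' → Σ ℕ λ bT → Σ ℕ λ bT' →
      length T ≡ n × length T' ≡ n ∸ 1 × ed T T' ≡ 1 ×
      IsB T bT × IsB T' bT' ×
      (3 * k ∸ 2) * bT < 2 * k * bT'

{-# OPTIONS --safe #-}
module Submission where

open import Defs
open import Data.Bool using (Bool; true; false; T; if_then_else_)
open import Data.Fin using (toℕ; fromℕ<)
open import Data.Fin.Properties using (pigeonhole; fromℕ<-injective; toℕ<n)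
open import Data.List using (List; []; _∷_; _++_; length; replicate; take; drop; map; upTo; cartesianProductWith)
open import Data.List.Membership.Propositional using (_∈_; find; lose)
open import Data.List.Membership.Propositional.Properties using (∈-cartesianProductWith⁺; ∈-upTo⁺)
open import Data.List.Properties using (≡-dec; length-replicate; length-take; length-drop; length-++; ++-cancelˡ)
open import Data.List.Relation.Unary.All using (All; []; _∷_)
open import Data.List.Relation.Unary.Any using (Any; here; there; any?)
open import Data.Nat using (ℕ; zero; suc; _+_; _*_; _∸_; _^_; _⊓_; _≤_; _<_; z≤n; s≤s; _≡ᵇ_; _<ᵇ_; _≤ᵇ_; _≟_; _≤?_; _<?_; >-nonZero)
open import Data.Nat.DivMod using (_/_; _%_; m≡m%n+[m/n]*n; m%n<n)
open import Data.Nat.Induction using (<-rec)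
open import Data.Nat.ListAction using (sum)
open import Data.Nat.Properties
open import Data.Nat.Tactic.RingSolver using (solve-∀)
open import Data.Product using (Σ; ∃; _×_; _,_; proj₁; proj₂)
open import Data.Sum using (_⊎_; inj₁; inj₂)
open import Data.Unit using (⊤; tt)
open import Function using (_∘_)
open import Level using (0ℓ)
open import Relation.Binary using (tri<; tri≈; tri>)
open import Relation.Binary.PropositionalEquality using (_≡_; _≢_; refl; sym; trans; cong; cong₂; subst; module ≡-Reasoning)
open import Relation.Nullary using (¬_; Dec; yes; no; contradiction; map′; _×-dec_; ¬?)
open import Relation.Unary using (Pred; Decidable)

-- The strings are a^P w b^Q followed by R blocks a^i z b^j, where i + j is constant, so that no block contains
-- another, separated by distinct delimiters (the first block needs none).  If w = z, each block occurs inside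
-- a^P w b^Q and costs one phrase besides its delimiter, so b ≤ 2R + 3 + [w ≠ b].  If w ≠ z, each block occurs only
-- once and costs two, so b ≥ 3R + 3 + [w ≠ b], because a phrase cannot cover a substring that does not recur.
-- For z = b, substituting w or inserting a letter in front of it turns w = b into w ≠ b; for z = w ≠ b, deleting w
-- puts the first b of b^Q in its place.

-- `IsB` asks for the exact minimum, whereas the argument only bounds it. Each string therefore
-- needs a constructive proof that a minimum exists: validity must be decidable, which means
-- replacing the unbounded search for a vanishing iterate of F by a single test, and the candidate
-- schemes of each size must be finite in number.
--
-- In the lower bound, a stretch s..e that does not recur forces a phrase start in the half-open
-- interval (s, e]. Stretches that share only an end position are thus charged separately, and head,
-- delimiters and pieces form one chain from left to right whose charges simply add up.
--
-- R rows of length R + 3 make the length quadratic in R while the gap is linear, whence the square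
-- root. A delimiter of its own for the first row would add one phrase to both bounds, and so one to
-- 3 b(T) - 2 b(T′). Deletion, where w ≠ b burdens T alone, has no room for that.

-- Orbits of a bounded map that reach 0

iter-+ : ∀ f i j x → iter f (i + j) x ≡ iter f i (iter f j x)
iter-+ f zero    j x = refl
iter-+ f (suc i) j x = cong f (iter-+ f i j x)

iter-fixed : ∀ {f x} → f x ≡ x → ∀ m → iter f m x ≡ x
iter-fixed         fx zero    = refl
iter-fixed {f} {x} fx (suc m) = trans (cong f (iter-fixed {f} fx m)) fx

iter-zero-mono : ∀ {f} → f 0 ≡ 0 → ∀ {x i j} → i ≤ j → iter f i x ≡ 0 → iter f j x ≡ 0
iter-zero-mono {f} f0 {x} {i} {j} i≤j eq = begin
  iter f j x                   ≡⟨ cong (λ t → iter f t x) (sym (m∸n+n≡m i≤j)) ⟩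
  iter f (j ∸ i + i) x         ≡⟨ iter-+ f (j ∸ i) i x ⟩
  iter f (j ∸ i) (iter f i x)  ≡⟨ cong (iter f (j ∸ i)) eq ⟩
  iter f (j ∸ i) 0             ≡⟨ iter-fixed {f} f0 (j ∸ i) ⟩
  0                            ∎
  where open ≡-Reasoning

iter-cycle : ∀ f d x → iter f d x ≡ x → ∀ c → iter f (c * d) x ≡ x
iter-cycle f d x eq zero    = refl
iter-cycle f d x eq (suc c) = trans (iter-+ f d (c * d) x) (trans (cong (iter f d) (iter-cycle f d x eq c)) eq)

iter-bounded : ∀ {f n} → (∀ x → f x ≤ n) → ∀ {x} → x ≤ n → ∀ m → iter f m x ≤ n
iter-bounded f≤n x≤n zero    = x≤n
iter-bounded f≤n x≤n (suc m) = f≤n _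

-- Two of the first n + 2 iterates coincide; from there on the orbit is periodic,
-- so if it ever vanishes it does so at the repeated iterate.
vanishes-early : ∀ {f n} → f 0 ≡ 0 → (∀ x → f x ≤ n) →
                 ∀ {x} → x ≤ n → ∀ m → iter f m x ≡ 0 → iter f (suc n) x ≡ 0
vanishes-early {f} {n} f0 f≤n {x} x≤n m eq
  with pigeonhole {m = suc n} {n = suc (suc n)} ≤-refl (λ i → fromℕ< (s≤s (iter-bounded {f} f≤n x≤n (toℕ i))))
... | i , j , i<j , same = iter-zero-mono {f} f0 {i = toℕ i} (<⇒≤ (<-≤-trans i<j (≤-pred (toℕ<n j)))) at-i
  where
  open ≡-Reasoning
  d : ℕ
  d = toℕ j ∸ toℕ i
  y : ℕ
  y = iter f (toℕ i) x
  cycle : iter f d y ≡ y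
  cycle = begin
    iter f d y            ≡⟨ sym (iter-+ f d (toℕ i) x) ⟩
    iter f (d + toℕ i) x  ≡⟨ cong (λ t → iter f t x) (m∸n+n≡m (<⇒≤ i<j)) ⟩
    iter f (toℕ j) x      ≡⟨ sym (fromℕ<-injective _ _ _ _ same) ⟩
    y                     ∎
  instance _ = >-nonZero (m<n⇒0<n∸m i<j)
  at-i : y ≡ 0
  at-i = begin
    y                            ≡⟨ sym (iter-cycle f d y cycle m) ⟩
    iter f (m * d) y             ≡⟨ sym (iter-+ f (m * d) (toℕ i) x) ⟩
    iter f (m * d + toℕ i) x     ≡⟨ iter-zero-mono {f} f0 {i = m} (≤-trans (m≤m*n m d) (m≤m+n (m * d) (toℕ i))) eq ⟩
    0                            ∎

-- Deciding validity and finding the minimum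

Fat-0 : ∀ p fs → Fat (suc p) fs 0 ≡ 0
Fat-0 p []              = refl
Fat-0 p (ground ∷ fs)   = Fat-0 (suc p) fs
Fat-0 p (copy ℓ q ∷ fs) = Fat-0 (p + ℓ) fs

-- Keeps every orbit of F inside [0..n], the finite set that the pigeonhole argument needs.
Fat-bounded : ∀ {S} p fs → PhrasesOK S p fs → ∀ x → Fat p fs x ≤ length S
Fat-bounded p []            ok x = z≤n
Fat-bounded {S} p (ground ∷ fs) (_ , ok) x with x ≡ᵇ p
... | true  = z≤n
... | false = Fat-bounded (suc p) fs (subst (λ t → PhrasesOK S t fs) (+-comm p 1) ok) x
Fat-bounded p (copy ℓ q ∷ fs) ((_ , _ , in-range , _) , ok) x
  with p ≤ᵇ x in p≤x | x <ᵇ p + ℓ in x<p+ℓ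
... | false | _     = Fat-bounded (p + ℓ) fs ok x
... | true  | false = Fat-bounded (p + ℓ) fs ok x
... | true  | true  = ≤-trans (≤-pred (≤-trans step (m≤n+m∸n (q + ℓ) 1))) in-range
  where
  step : q + (x ∸ p) < q + ℓ
  step = +-monoʳ-< q (m<n+o⇒m∸n<o x p {{>-nonZero (ℓ>0 (≤ᵇ⇒≤ p x (subst T (sym p≤x) tt)) lt)}} lt)
    where
    lt : x < p + ℓ
    lt = <ᵇ⇒< x (p + ℓ) (subst T (sym x<p+ℓ) tt)
    ℓ>0 : p ≤ x → x < p + ℓ → 0 < ℓ
    ℓ>0 p≤x x< = +-cancelˡ-< p 0 ℓ (≤-<-trans (≤-reflexive (+-identityʳ p)) (≤-<-trans p≤x x<))

phraseOK? : ∀ T p f → Dec (PhraseOK T p f)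
phraseOK? T p ground     = yes tt
phraseOK? T p (copy ℓ q) =
  (1 ≤? ℓ) ×-dec (1 ≤? q) ×-dec (q + ℓ ∸ 1 ≤? length T) ×-dec ¬? (q ≟ p) ×-dec
  ≡-dec _≟_ (substr T q ℓ) (substr T p ℓ)

phrasesOK? : ∀ T p fs → Dec (PhrasesOK T p fs)
phrasesOK? T p []       = yes tt
phrasesOK? T p (f ∷ fs) = phraseOK? T p f ×-dec phrasesOK? T (p + len f) fs

-- Termination asks for some m without a bound, but an orbit in [0..n] that vanishes has done so by
-- iterate n + 1, so this one iterate decides it. The phrases are checked first because the bound on
-- F rests on them.
validScheme? : ∀ T → Decidable (ValidScheme T)
validScheme? T fs with sum (map len fs) ≟ length T | phrasesOK? T 1 fs
... | no ¬s | _ = no (¬s ∘ proj₁)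
... | yes _ | no ¬ok = no (¬ok ∘ proj₁ ∘ proj₂)
... | yes s | yes ok = map′
        (λ vanish → s , ok , λ x _ x≤n → suc (length T) , vanish (s≤s x≤n))
        (λ v {x} x≤n → to v x (≤-pred x≤n))
        (allUpTo? (λ x → iter (F fs) (suc (length T)) x ≟ 0) (suc (length T)))
  where
  F0 : F fs 0 ≡ 0
  F0 = Fat-0 0 fs
  to : ValidScheme T fs → ∀ x → x ≤ length T → iter (F fs) (suc (length T)) x ≡ 0
  to _             zero    _   = iter-fixed {F fs} F0 (suc (length T))
  to (_ , _ , fin) (suc x) x≤n =
    let m , eq = fin (suc x) (s≤s z≤n) x≤n in
    vanishes-early {F fs} F0 (Fat-bounded 1 fs ok) x≤n m eq

-- A finite supply for the search: an admissible copy lies inside the string, so its length and its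
-- source are at most n.
phrases : ℕ → List Phrase
phrases n = ground ∷ cartesianProductWith copy (upTo (suc n)) (upTo (suc n))

phrases-complete : ∀ T p fs → PhrasesOK T p fs → All (_∈ phrases (length T)) fs
phrases-complete T p []              ok = []
phrases-complete T p (ground ∷ fs)   (_ , ok) = here refl ∷ phrases-complete T (p + 1) fs ok
phrases-complete T p (copy (suc ℓ) (suc q) ∷ fs) ((_ , _ , in-range , _) , ok) =
  there (∈-cartesianProductWith⁺ copy
    (∈-upTo⁺ (s≤s (≤-trans (m≤n+m (suc ℓ) q) in-range)))
    (∈-upTo⁺ (s≤s (≤-trans (≤-trans (m≤m+n (suc q) ℓ) (≤-reflexive (sym (+-suc q ℓ)))) in-range))))
  ∷ phrases-complete T (p + suc ℓ) fs ok

ListOver : ∀ {A : Set} → List A → ℕ → Pred (List A) 0ℓ → Set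
ListOver xs k Q = ∃ λ ys → (All (_∈ xs) ys × length ys ≡ k) × Q ys

listOver? : ∀ {A : Set} (xs : List A) k {Q : Pred (List A) 0ℓ} → Decidable Q → Dec (ListOver xs k Q)
listOver? xs zero Q? = map′
  (λ q → [] , ([] , refl) , q)
  (λ where ([] , _ , q) → q)
  (Q? [])
listOver? xs (suc k) {Q} Q? = map′ to from (any? (λ y → listOver? xs k (λ ys → Q? (y ∷ ys))) xs)
  where
  to : Any (λ y → ListOver xs k (Q ∘ (y ∷_))) xs → ListOver xs (suc k) Q
  to ex with find ex
  ... | y , y∈ , ys , (ys∈ , eq) , q = y ∷ ys , (y∈ ∷ ys∈ , cong suc eq) , q
  from : ListOver xs (suc k) Q → Any (λ y → ListOver xs k (Q ∘ (y ∷_))) xs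
  from (y ∷ ys , (y∈ ∷ ys∈ , eq) , q) = lose y∈ (ys , (ys∈ , suc-injective eq) , q)

least : ∀ {P : ℕ → Set} → Decidable P → ∀ n → P n → ∃ λ k → P k × (∀ j → P j → k ≤ j)
least {P} P? = <-rec _ step
  where
  step : ∀ n → (∀ {k} → k < n → P k → ∃ λ l → P l × (∀ j → P j → l ≤ j)) →
         P n → ∃ λ k → P k × (∀ j → P j → k ≤ j)
  step n rec pn with anyUpTo? P? n
  ... | yes (k , k<n , pk) = rec k<n pk
  ... | no none = n , pn , λ j pj → ≮⇒≥ (λ j<n → none (j , j<n , pj))

-- For each size only finitely many lists over `phrases` have to be tested; the given scheme
-- supplies a size at which the test succeeds.
IsB-exists : ∀ T fs → ValidScheme T fs → ∃ (IsB T)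
IsB-exists T fs valid
  with least (λ k → listOver? (phrases (length T)) k (validScheme? T)) (length fs)
             (fs , (phrases-complete T 1 fs (proj₁ (proj₂ valid)) , refl) , valid)
... | k , (gs , (_ , eq) , gs-valid) , min =
  k , (gs , gs-valid , eq) ,
  λ hs hs-valid → min _ (hs , (phrases-complete T 1 hs (proj₁ (proj₂ hs-valid)) , refl) , hs-valid)

-- Reading single letters

-- 0-indexed; positions past the end read as 0, which never occurs in the strings below.
at : Str → ℕ → ℕ
at []       _       = 0
at (x ∷ xs) zero    = x
at (x ∷ xs) (suc k) = at xs k

at-drop : ∀ q xs k → at (drop q xs) k ≡ at xs (q + k)
at-drop zero    xs       k = refl
at-drop (suc q) []       k = refl
at-drop (suc q) (x ∷ xs) k = at-drop q xs k

at-take : ∀ {ℓ k} xs → k < ℓ → at (take ℓ xs) k ≡ at xs k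
at-take {zero}          []       _         = refl
at-take {suc _}         []       _         = refl
at-take {suc _} {zero}  (x ∷ xs) _         = refl
at-take {suc _} {suc _} (x ∷ xs) (s≤s k<ℓ) = at-take xs k<ℓ

at-substr : ∀ S q ℓ {k} → k < ℓ → at (substr S (suc q) ℓ) k ≡ at S (q + k)
at-substr S q ℓ {k} k<ℓ = trans (at-take (drop q S) k<ℓ) (at-drop q S k)

at-ext : ∀ xs ys → length xs ≡ length ys → (∀ k → k < length xs → at xs k ≡ at ys k) → xs ≡ ys
at-ext []       []       _  _    = refl
at-ext (x ∷ xs) (y ∷ ys) eq same =
  cong₂ _∷_ (same 0 (s≤s z≤n)) (at-ext xs ys (suc-injective eq) (λ k k< → same (suc k) (s≤s k<)))

length-substr : ∀ S q ℓ → q + ℓ ≤ length S → length (substr S (suc q) ℓ) ≡ ℓ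
length-substr S q ℓ q+ℓ≤ = begin
  length (take ℓ (drop q S))  ≡⟨ length-take ℓ (drop q S) ⟩
  ℓ ⊓ length (drop q S)       ≡⟨ cong (ℓ ⊓_) (length-drop q S) ⟩
  ℓ ⊓ (length S ∸ q)          ≡⟨ m≤n⇒m⊓n≡m (m+n≤o⇒m≤o∸n ℓ (≤-trans (≤-reflexive (+-comm ℓ q)) q+ℓ≤)) ⟩
  ℓ                           ∎
  where open ≡-Reasoning

at-++ˡ : ∀ xs ys {k} → k < length xs → at (xs ++ ys) k ≡ at xs k
at-++ˡ (x ∷ xs) ys {zero}  _         = refl
at-++ˡ (x ∷ xs) ys {suc k} (s≤s k<) = at-++ˡ xs ys k<

at-++ʳ : ∀ xs ys k → at (xs ++ ys) (length xs + k) ≡ at ys k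
at-++ʳ []       ys k = refl
at-++ʳ (x ∷ xs) ys k = at-++ʳ xs ys k

at-replicate : ∀ n c {k} → k < n → at (replicate n c) k ≡ c
at-replicate (suc n) c {zero}  _        = refl
at-replicate (suc n) c {suc k} (s≤s k<) = at-replicate n c k<

-- Schemes that copy only from the left

-- Sources to the left of their phrases make F decrease, which settles termination.
LeftPhrase : Str → ℕ → Phrase → Set
LeftPhrase S p ground     = ⊤
LeftPhrase S p (copy ℓ q) =
  1 ≤ ℓ × ∃ λ r → q ≡ suc r × r < p × (∀ k → k < ℓ → at S (r + k) ≡ at S (p + k))

LeftScheme : Str → ℕ → List Phrase → Set
LeftScheme S p []       = p ≡ length S
LeftScheme S p (f ∷ fs) = LeftPhrase S p f × LeftScheme S (p + len f) fs

left-sum : ∀ S p fs → LeftScheme S p fs → p + sum (map len fs) ≡ length S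
left-sum S p []       eq        = trans (+-identityʳ p) eq
left-sum S p (f ∷ fs) (_ , ok) =
  trans (sym (+-assoc p (len f) (sum (map len fs)))) (left-sum S (p + len f) fs ok)

left-phrasesOK : ∀ S p fs → LeftScheme S p fs → PhrasesOK S (suc p) fs
left-phrasesOK S p []            _         = tt
left-phrasesOK S p (ground ∷ fs) (_ , ok) = tt , left-phrasesOK S (p + 1) fs ok
left-phrasesOK S p (copy ℓ _ ∷ fs) ((1≤ℓ , r , refl , r<p , same) , ok) =
  (1≤ℓ , s≤s z≤n , r-range , (λ eq → <⇒≢ r<p (suc-injective eq)) , at-ext _ _ lengths pointwise) ,
  left-phrasesOK S (p + ℓ) fs ok
  where
  p-range : p + ℓ ≤ length S
  p-range = ≤-trans (m≤m+n (p + ℓ) (sum (map len fs))) (≤-reflexive (left-sum S (p + ℓ) fs ok))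
  r-range : r + ℓ ≤ length S
  r-range = ≤-trans (+-monoˡ-≤ ℓ (<⇒≤ r<p)) p-range
  lengths : length (substr S (suc r) ℓ) ≡ length (substr S (suc p) ℓ)
  lengths = trans (length-substr S r ℓ r-range) (sym (length-substr S p ℓ p-range))
  pointwise : ∀ k → k < length (substr S (suc r) ℓ) → at (substr S (suc r) ℓ) k ≡ at (substr S (suc p) ℓ) k
  pointwise k k< = trans (at-substr S r ℓ k<ℓ) (trans (same k k<ℓ) (sym (at-substr S p ℓ k<ℓ)))
    where
    k<ℓ : k < ℓ
    k<ℓ = subst (k <_) (length-substr S r ℓ r-range) k<

left-decreasing : ∀ S p fs → LeftScheme S p fs → ∀ x → Fat (suc p) fs (suc x) < suc x
left-decreasing S p []            _        x = s≤s z≤n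
left-decreasing S p (ground ∷ fs) (_ , ok) x with x ≡ᵇ p
... | true  = s≤s z≤n
... | false = subst (λ t → Fat (suc t) fs (suc x) < suc x) (+-comm p 1) (left-decreasing S (p + 1) fs ok x)
left-decreasing S p (copy ℓ _ ∷ fs) ((_ , r , refl , r<p , _) , ok) x
  with p <ᵇ suc x in p≤x | x <ᵇ p + ℓ
... | false | _     = left-decreasing S (p + ℓ) fs ok x
... | true  | false = left-decreasing S (p + ℓ) fs ok x
... | true  | true  = s≤s (≤-trans (+-monoˡ-≤ (x ∸ p) r<p) (≤-reflexive (m+[n∸m]≡n (≤-pred (<ᵇ⇒< p (suc x) (subst T (sym p≤x) tt))))))

iter-decreasing : ∀ {f} → f 0 ≡ 0 → (∀ x → f (suc x) < suc x) → ∀ x → ∃ λ m → iter f m x ≡ 0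
iter-decreasing {f} f0 dec = <-rec _ step
  where
  step : ∀ x → (∀ {y} → y < x → ∃ λ m → iter f m y ≡ 0) → ∃ λ m → iter f m x ≡ 0
  step zero    rec = 0 , refl
  step (suc x) rec = let m , eq = rec (dec x) in
    m + 1 , trans (iter-+ f m 1 (suc x)) eq

left-valid : ∀ S fs → LeftScheme S 0 fs → ValidScheme S fs
left-valid S fs ok =
  left-sum S 0 fs ok , left-phrasesOK S 0 fs ok ,
  λ x _ _ → iter-decreasing {F fs} (Fat-0 0 fs) (left-decreasing S 0 fs ok) x

all-ground : ∀ S p n → p + n ≡ length S → LeftScheme S p (replicate n ground)
all-ground S p zero    eq = trans (sym (+-identityʳ p)) eq
all-ground S p (suc n) eq = tt , all-ground S (p + 1) n (trans (+-assoc p 1 n) eq)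

b-exists : ∀ S → ∃ (IsB S)
b-exists S = IsB-exists S (replicate (length S) ground) (left-valid S _ (all-ground S 0 (length S) refl))

-- Nonrecurring stretches force phrase starts

-- The values at `e` and at `s` differ by the number of phrase starts in (s, e]. Starts never
-- decrease along the list, so counting may stop at the first one beyond `x`.
startsUpTo : ℕ → List Phrase → ℕ → ℕ
startsUpTo p []       x = 0
startsUpTo p (f ∷ fs) x = if p ≤ᵇ x then suc (startsUpTo (p + len f) fs x) else 0

starts-≥ : ∀ {p x} f fs → p ≤ x → startsUpTo p (f ∷ fs) x ≡ suc (startsUpTo (p + len f) fs x)
starts-≥ {p} {x} f fs p≤x with p ≤ᵇ x | ≤⇒≤ᵇ p≤x
... | true | _ = refl

starts-< : ∀ {p x} fs → x < p → startsUpTo p fs x ≡ 0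
starts-<         []       x<p = refl
starts-< {p} {x} (f ∷ fs) x<p with p ≤ᵇ x in eq
... | true  = contradiction (≤ᵇ⇒≤ p x (subst T (sym eq) tt)) (<⇒≱ x<p)
... | false = refl

starts≤length : ∀ p fs x → startsUpTo p fs x ≤ length fs
starts≤length p []       x = z≤n
starts≤length p (f ∷ fs) x with p ≤ᵇ x
... | true  = s≤s (starts≤length (p + len f) fs x)
... | false = z≤n

starts-positive : ∀ {p x} fs → p ≤ x → x < p + sum (map len fs) → 1 ≤ startsUpTo p fs x
starts-positive {p} []       p≤x x< = contradiction (<-≤-trans x< (≤-reflexive (+-identityʳ p))) (≤⇒≯ p≤x)
starts-positive     (f ∷ fs) p≤x x< = ≤-trans (s≤s z≤n) (≤-reflexive (sym (starts-≥ f fs p≤x)))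

-- The second occurrence is not confined to `S`: past the end `at` reads 0, which differs from every
-- letter of the strings in question, so an overrun cannot match.
Recurs : Str → ℕ → ℕ → Set
Recurs S s e = ∃ λ q → q ≢ s × (∀ k → s + k ≤ e → at S (q + k) ≡ at S (s + k))

-- Consider the phrase that holds `s`. If it ends before `e`, the next one starts in (s, e].
-- Otherwise it holds the whole stretch, so by `s < e` it is a copy, and its source, shifted by the
-- offset `t` of `s` in the phrase, is a second occurrence.
cut-or-recurs : ∀ {S s e} p fs → PhrasesOK S (suc p) fs → p ≤ s → s < e → e < p + sum (map len fs) →
                suc (startsUpTo p fs s) ≤ startsUpTo p fs e ⊎ Recurs S s e
cut-or-recurs p [] _ p≤s s<e e< =
  contradiction (<-≤-trans e< (≤-reflexive (+-identityʳ p))) (≤⇒≯ (≤-trans p≤s (<⇒≤ s<e)))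
cut-or-recurs {S} {s} {e} p (f ∷ fs) (ok , oks) p≤s s<e e<
  rewrite starts-≥ f fs p≤s | starts-≥ f fs (≤-trans p≤s (<⇒≤ s<e)) | sym (+-assoc p (len f) (sum (map len fs)))
  with p + len f ≤? s
... | yes next≤s with cut-or-recurs (p + len f) fs oks next≤s s<e e<
...   | inj₁ cut = inj₁ (s≤s cut)
...   | inj₂ rec = inj₂ rec
cut-or-recurs {S} {s} {e} p (f ∷ fs) (ok , oks) p≤s s<e e<
    | no next≰s rewrite starts-< fs (≰⇒> next≰s) with p + len f ≤? e
... | yes next≤e = inj₁ (s≤s (starts-positive fs next≤e e<))
cut-or-recurs {S} {s} {e} p (ground ∷ fs) (ok , oks) p≤s s<e e<
    | no next≰s | no next≰e =
  contradiction (≤-<-trans (s≤s p≤s) (≤-<-trans s<e (≰⇒> next≰e))) (≤⇒≯ (≤-reflexive (+-comm p 1)))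
cut-or-recurs {S} {s} {e} p (copy ℓ (suc r) ∷ fs) ((_ , _ , _ , r≢p , same) , oks) p≤s s<e e<
    | no next≰s | no next≰e with m≤n⇒∃[o]m+o≡n p≤s
... | t , refl = inj₂ (r + t , (λ eq → r≢p (cong suc (+-cancelʳ-≡ t r p eq))) , copied)
  where
  open ≡-Reasoning
  copied : ∀ k → p + t + k ≤ e → at S (r + t + k) ≡ at S (p + t + k)
  copied k k≤ = begin
    at S (r + t + k)                    ≡⟨ cong (at S) (+-assoc r t k) ⟩
    at S (r + (t + k))                  ≡⟨ sym (at-substr S r ℓ in-phrase) ⟩
    at (substr S (suc r) ℓ) (t + k)     ≡⟨ cong (λ u → at u (t + k)) same ⟩
    at (substr S (suc p) ℓ) (t + k)     ≡⟨ at-substr S p ℓ in-phrase ⟩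
    at S (p + (t + k))                  ≡⟨ cong (at S) (sym (+-assoc p t k)) ⟩
    at S (p + t + k)                    ∎
    where
    in-phrase : t + k < ℓ
    in-phrase = +-cancelˡ-< p (t + k) ℓ (≤-<-trans (≤-reflexive (sym (+-assoc p t k))) (≤-<-trans k≤ (≰⇒> next≰e)))

unique-cut : ∀ {S s e} fs → ValidScheme S fs → s < e → e < length S → ¬ Recurs S s e →
             suc (startsUpTo 0 fs s) ≤ startsUpTo 0 fs e
unique-cut fs (total , ok , _) s<e e< unique
  with cut-or-recurs 0 fs ok z≤n s<e (<-≤-trans e< (≤-reflexive (sym total)))
... | inj₁ cut = cut
... | inj₂ rec = contradiction rec unique

-- Edit distance one

≡ᵇ-refl : ∀ n → (n ≡ᵇ n) ≡ true
≡ᵇ-refl zero    = refl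
≡ᵇ-refl (suc n) = ≡ᵇ-refl n

ed-refl : ∀ xs → ed xs xs ≡ 0
ed-refl []       = refl
ed-refl (x ∷ xs) rewrite ≡ᵇ-refl x | ed-refl xs = refl

ed≡0⇒≡ : ∀ xs ys → ed xs ys ≡ 0 → xs ≡ ys
ed≡0⇒≡ []       []       _  = refl
ed≡0⇒≡ (x ∷ xs) (y ∷ ys) eq with x ≡ᵇ y in x≡y
... | true  with ed xs ys in eq′
...   | zero = cong₂ _∷_ (≡ᵇ⇒≡ x y (subst T (sym x≡y) tt)) (ed≡0⇒≡ xs ys eq′)
ed≡0⇒≡ (x ∷ xs) (y ∷ ys) eq | false with ed xs ys
ed≡0⇒≡ (x ∷ xs) (y ∷ ys) () | false | zero
ed≡0⇒≡ (x ∷ xs) (y ∷ ys) () | false | suc _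

ed-++-≤ : ∀ us xs ys → ed (us ++ xs) (us ++ ys) ≤ ed xs ys
ed-++-≤ []       xs ys = ≤-refl
ed-++-≤ (u ∷ us) xs ys rewrite ≡ᵇ-refl u =
  ≤-trans (m⊓n≤m _ _) (≤-trans (≤-reflexive (+-identityʳ _)) (ed-++-≤ us xs ys))

ed-substitute : ∀ x y zs → ed (x ∷ zs) (y ∷ zs) ≤ 1
ed-substitute x y zs rewrite ed-refl zs with x ≡ᵇ y
... | true  = z≤n
... | false = ≤-refl

ed-insert : ∀ y zs → ed zs (y ∷ zs) ≤ 1
ed-insert y []       = ≤-refl
ed-insert y (z ∷ zs) rewrite ed-refl (z ∷ zs) =
  ≤-trans (m⊓n≤n _ _) (s≤s (m⊓n≤n (ed zs (y ∷ z ∷ zs)) 0))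

ed-delete : ∀ x zs → ed (x ∷ zs) zs ≤ 1
ed-delete x []       = ≤-refl
ed-delete x (z ∷ zs) rewrite ed-refl (z ∷ zs) = ≤-trans (m⊓n≤n _ _) (s≤s z≤n)

-- Matching the common prefix letter by letter gives the upper bound. Distance 0 would make the
-- strings equal, and cancelling the prefix would contradict `xs ≢ ys`.
ed≡1 : ∀ us xs ys → xs ≢ ys → ed xs ys ≤ 1 → ed (us ++ xs) (us ++ ys) ≡ 1
ed≡1 us xs ys xs≢ys ≤1 = ≤-antisym (≤-trans (ed-++-≤ us xs ys) ≤1)
  (n≢0⇒n>0 (λ eq → xs≢ys (++-cancelˡ us _ _ (ed≡0⇒≡ _ _ eq))))

-- The strings and their letters

pattern a = 1
pattern b = 2

-- The flag says whether the letter differs from `b`. It encodes both w (as `ω`) and z (as `ζ`), so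
-- that `ω ≡ ζ` expresses w = z.
mark : Bool → ℕ
mark false = b
mark true  = 3

-- The delimiter of row 0 is a b: it prolongs the b-run in front of it and costs no phrase of its own.
delim : ℕ → ℕ
delim zero    = b
delim (suc j) = 4 + j

row : ℕ → ℕ → ℕ → Str
row z j β = delim j ∷ replicate (suc j) a ++ z ∷ replicate β b

rows : ℕ → ℕ → ℕ → Str
rows z j zero    = []
rows z j (suc k) = row z j (suc k) ++ rows z (suc j) k

length-row : ∀ z j β → length (row z j β) ≡ 3 + (j + β)
length-row z j β = cong suc (begin
  length (replicate (suc j) a ++ z ∷ replicate β b)  ≡⟨ length-++ (replicate (suc j) a) ⟩
  length (replicate (suc j) a) + suc (length (replicate β b))
    ≡⟨ cong₂ (λ u v → u + suc v) (length-replicate (suc j)) (length-replicate β) ⟩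
  suc j + suc β                                      ≡⟨ cong suc (+-suc j β) ⟩
  2 + (j + β)                                        ∎)
  where open ≡-Reasoning

length-rows : ∀ z j k → length (rows z j k) ≡ k * (3 + (j + k))
length-rows z j zero    = refl
length-rows z j (suc k) = trans (length-++ (row z j (suc k))) (cong₂ _+_
  (length-row z j (suc k))
  (trans (length-rows z (suc j) k) (cong (λ t → k * (3 + t)) (sym (+-suc j k)))))

row-a : ∀ z j β {i} → i ≤ j → at (row z j β) (suc i) ≡ a
row-a z j β {i} i≤j = trans
  (at-++ˡ (replicate (suc j) a) _ (subst (i <_) (sym (length-replicate (suc j))) (s≤s i≤j)))
  (at-replicate (suc j) a (s≤s i≤j))

row-past-a : ∀ z j β k → at (row z j β) (2 + (j + k)) ≡ at (z ∷ replicate β b) k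
row-past-a z j β k = trans
  (cong (λ t → at (row z j β) (suc (t + k))) (sym (length-replicate (suc j))))
  (at-++ʳ (replicate (suc j) a) (z ∷ replicate β b) k)

-- Since `j` rises while the number of b's falls, all rows have one length and row `j′` starts at a
-- multiple of it. Writing the count as `j′ + suc β` makes the row exist and avoids subtraction.
at-rows : ∀ z j j′ β {c} → c < 3 + (j + j′ + suc β) →
          at (rows z j (j′ + suc β)) (j′ * (3 + (j + j′ + suc β)) + c) ≡ at (row z (j + j′) (suc β)) c
at-rows z j zero β c< rewrite +-identityʳ j =
  at-++ˡ (row z j (suc β)) _ (<-≤-trans c< (≤-reflexive (sym (length-row z j (suc β)))))
at-rows z j (suc j′) β {c} c< rewrite +-suc j j′ = begin
  at (row z j k ++ rest) (M + j′ * M + c)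
    ≡⟨ cong (at (row z j k ++ rest)) (trans (+-assoc M (j′ * M) c) (cong (_+ (j′ * M + c)) (sym M≡))) ⟩
  at (row z j k ++ rest) (length (row z j k) + (j′ * M + c))
    ≡⟨ at-++ʳ (row z j k) rest (j′ * M + c) ⟩
  at rest (j′ * M + c)
    ≡⟨ at-rows z (suc j) j′ β c< ⟩
  at (row z (suc (j + j′)) (suc β)) c ∎
  where
  open ≡-Reasoning
  k M : ℕ
  k = suc (j′ + suc β)
  M = 3 + (suc (j + j′) + suc β)
  rest : Str
  rest = rows z (suc j) (j′ + suc β)
  M≡ : length (row z j k) ≡ M
  M≡ = trans (length-row z j k) (cong (3 +_) (arith j j′ β))
    where
    arith : ∀ j j′ β → j + suc (j′ + suc β) ≡ suc (j + j′) + suc β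
    arith = solve-∀

at-end : ∀ xs {k} → length xs ≤ k → at xs k ≡ 0
at-end []       _          = refl
at-end (x ∷ xs) (s≤s len≤) = at-end xs len≤

-- a^P w b^Q followed by the rows d_j a^(j+1) z b^(R-j), j < R, all of length R + 3.
string : ℕ → ℕ → ℕ → Bool → Bool → Str
string P Q R ω ζ = replicate P a ++ mark ω ∷ replicate Q b ++ rows (mark ζ) 0 R

module Strings (P′ Q R′ : ℕ) (ω ζ : Bool) (R≤P′ : suc R′ ≤ P′) (R<Q : suc R′ < Q) where
  R P M base : ℕ
  R = suc R′
  P = suc P′
  M = 3 + R
  base = P + suc Q

  S : Str
  S = string P Q R ω ζ

  pos : ℕ → ℕ → ℕ
  pos j c = base + (j * M + c)

  pos-+ : ∀ j c k → pos j c + k ≡ pos j (c + k)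
  pos-+ j c k = trans (+-assoc base (j * M + c) k) (cong (base +_) (+-assoc (j * M) c k))

  pos-suc : ∀ j c → suc (pos j c) ≡ pos j (suc c)
  pos-suc j c = trans (+-comm 1 (pos j c)) (trans (pos-+ j c 1) (cong (pos j) (+-comm c 1)))

  pos-next : ∀ j → pos j M ≡ pos (suc j) 0
  pos-next j = cong (base +_) (trans (+-comm (j * M) M) (sym (+-identityʳ (M + j * M))))

  -- Opaque, so that x can be inferred from letter x.
  opaque
    letter : ℕ → ℕ
    letter = at S

    at-a : ∀ {k} → k < P → letter k ≡ a
    at-a {k} k<P = trans (at-++ˡ (replicate P a) _ {k} (subst (k <_) (sym (length-replicate P)) k<P)) (at-replicate P a {k} k<P)

    past-a : ∀ k → at S (P + k) ≡ at (mark ω ∷ replicate Q b ++ rows (mark ζ) 0 R) k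
    past-a k = trans (cong (λ t → at S (t + k)) (sym (length-replicate P))) (at-++ʳ (replicate P a) _ k)

    at-w : letter P ≡ mark ω
    at-w = trans (cong (at S) (sym (+-identityʳ P))) (past-a 0)

    past-b : ∀ k → at S (base + k) ≡ at (rows (mark ζ) 0 R) k
    past-b k = begin
      at S (P + suc Q + k)    ≡⟨ cong (at S) (+-assoc P (suc Q) k) ⟩
      at S (P + suc (Q + k))  ≡⟨ past-a (suc (Q + k)) ⟩
      at tl (Q + k)           ≡⟨ cong (λ t → at tl (t + k)) (sym (length-replicate Q)) ⟩
      at tl (length (replicate Q b) + k)  ≡⟨ at-++ʳ (replicate Q b) _ k ⟩
      at (rows (mark ζ) 0 R) k  ∎
      where
      open ≡-Reasoning
      tl : Str
      tl = replicate Q b ++ rows (mark ζ) 0 R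

    at-cell : ∀ {j c} → j < R → c < M → ∃ λ β → R ≡ j + suc β × letter (pos j c) ≡ at (row (mark ζ) j (suc β)) c
    at-cell {j} {c} j<R c<M with m≤n⇒∃[o]m+o≡n j<R
    ... | β , eq = β , R≡ , trans (past-b (j * M + c)) cell
      where
      R≡ : R ≡ j + suc β
      R≡ = trans (sym eq) (sym (+-suc j β))
      cell : at (rows (mark ζ) 0 R) (j * M + c) ≡ at (row (mark ζ) j (suc β)) c
      cell = subst (λ t → at (rows (mark ζ) 0 t) (j * (3 + t) + c) ≡ at (row (mark ζ) j (suc β)) c) (sym R≡)
               (at-rows (mark ζ) 0 j β (subst (λ t → c < 3 + t) R≡ c<M))

    at-d : ∀ {j} → j < R → letter (pos j 0) ≡ delim j
    at-d j<R = let _ , _ , eq = at-cell j<R (s≤s z≤n) in eq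

    at-ra : ∀ {j i} → j < R → i ≤ j → letter (pos j (suc i)) ≡ a
    at-ra {j} j<R i≤j =
      let β , _ , eq = at-cell j<R (s≤s (≤-trans (s≤s (≤-trans i≤j (<⇒≤ j<R))) (n≤1+n _))) in
      trans eq (row-a (mark ζ) j (suc β) i≤j)

    at-rz : ∀ {j} → j < R → letter (pos j (2 + j)) ≡ mark ζ
    at-rz {j} j<R =
      let β , _ , eq = at-cell {j} {2 + j} j<R (s≤s (s≤s (s≤s (<⇒≤ j<R)))) in
      trans eq (trans (cong (λ t → at (row (mark ζ) j (suc β)) (2 + t)) (sym (+-identityʳ j)))
                      (row-past-a (mark ζ) j (suc β) 0))

    at-rb : ∀ {j c} → j < R → 3 + j ≤ c → c < M → letter (pos j c) ≡ b
    at-rb {j} j<R j≤c c<M with m≤n⇒∃[o]m+o≡n j≤c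
    ... | i , refl = let β , R≡ , eq = at-cell j<R c<M in
      trans eq (trans (cong (λ t → at (row (mark ζ) j (suc β)) (2 + t)) (sym (+-suc j i)))
               (trans (row-past-a (mark ζ) j (suc β) (suc i))
                      (at-replicate (suc β) b (+-cancelˡ-< j i (suc β) (subst (j + i <_) R≡ (≤-pred (≤-pred (≤-pred c<M))))))))

    -- The range goes one beyond b^Q: at `k = Q` stands the delimiter of row 0, itself a b.
    at-b : ∀ {k} → k ≤ Q → letter (P + suc k) ≡ b
    at-b {k} k≤Q with m≤n⇒m<n∨m≡n k≤Q
    ... | inj₁ k<Q = trans (past-a (suc k))
      (trans (at-++ˡ (replicate Q b) _ (subst (k <_) (sym (length-replicate Q)) k<Q)) (at-replicate Q b k<Q))
    ... | inj₂ refl = trans (cong (at S) (sym (+-identityʳ base))) (at-d {0} (s≤s z≤n))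

    letter-end : ∀ {x} → length S ≤ x → letter x ≡ 0
    letter-end = at-end S

    recurs-letter : ∀ {s e} → Recurs S s e → ∃ λ q → q ≢ s × (∀ k → s + k ≤ e → letter (q + k) ≡ letter (s + k))
    recurs-letter rec = rec

    letter-at : ∀ {x y} → letter x ≡ letter y → at S x ≡ at S y
    letter-at eq = eq

  length-S : length S ≡ pos R 0
  length-S = begin
    length S  ≡⟨ length-++ (replicate P a) ⟩
    length (replicate P a) + suc (length (replicate Q b ++ rows (mark ζ) 0 R))
      ≡⟨ cong₂ (λ u v → u + suc v) (length-replicate P) (length-++ (replicate Q b)) ⟩
    P + suc (length (replicate Q b) + length (rows (mark ζ) 0 R))
      ≡⟨ cong₂ (λ u v → P + suc (u + v)) (length-replicate Q) (length-rows (mark ζ) 0 R) ⟩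
    P + (suc Q + R * M)  ≡⟨ sym (+-assoc P (suc Q) (R * M)) ⟩
    base + R * M         ≡⟨ cong (base +_) (sym (+-identityʳ (R * M))) ⟩
    pos R 0              ∎
    where open ≡-Reasoning

  -- Uniqueness proofs split on where an alleged second occurrence lies; each case fixes the letter
  -- there, through `char`.
  data Place (x : ℕ) : Set where
    inA  : x < P → Place x
    inW  : x ≡ P → Place x
    inB  : ∀ k → k < Q → x ≡ P + suc k → Place x
    inD  : ∀ j → j < R → x ≡ pos j 0 → Place x
    inRA : ∀ j i → j < R → i ≤ j → x ≡ pos j (suc i) → Place x
    inRZ : ∀ j → j < R → x ≡ pos j (2 + j) → Place x
    inRB : ∀ j c → j < R → 3 + j ≤ c → c < M → x ≡ pos j c → Place x
    past : length S ≤ x → Place x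

  char : ∀ {x} → Place x → ℕ
  char (inA _)            = a
  char (inW _)            = mark ω
  char (inB _ _ _)        = b
  char (inD j _ _)        = delim j
  char (inRA _ _ _ _ _)   = a
  char (inRZ _ _ _)       = mark ζ
  char (inRB _ _ _ _ _ _) = b
  char (past _)           = 0

  at-place : ∀ {x} (p : Place x) → letter x ≡ char p
  at-place (inA x<P)                = at-a x<P
  at-place (inW refl)               = at-w
  at-place (inB k k<Q refl)         = at-b (<⇒≤ k<Q)
  at-place (inD j j<R refl)         = at-d j<R
  at-place (inRA j i j<R i≤j refl)  = at-ra j<R i≤j
  at-place (inRZ j j<R refl)        = at-rz j<R
  at-place (inRB j c j<R j≤c c<M refl) = at-rb j<R j≤c c<M
  at-place (past len≤)              = letter-end len≤

  place-row : ∀ j c → j < R → c < M → Place (pos j c)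
  place-row j zero    j<R c<M = inD j j<R refl
  place-row j (suc i) j<R c<M with <-cmp i (suc j)
  ... | tri< i<j _ _ = inRA j i j<R (≤-pred i<j) refl
  ... | tri≈ _ refl _ = inRZ j j<R refl
  ... | tri> _ _ j<i = inRB j (suc i) j<R (s≤s j<i) c<M refl

  place : ∀ x → Place x
  place x with <-cmp x P
  ... | tri< x<P _ _ = inA x<P
  ... | tri≈ _ x≡P _ = inW x≡P
  ... | tri> _ _ P<x with m≤n⇒∃[o]m+o≡n P<x
  ...   | k , refl with k <? Q
  ...     | yes k<Q = inB k k<Q (sym (+-suc P k))
  ...     | no k≮Q with m≤n⇒∃[o]m+o≡n (≮⇒≥ k≮Q)
  ...       | y , refl with y / M <? R
  -- Behind b^Q, row and cell are quotient and remainder by the common row length.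
  ...         | yes r<R = subst Place eq (place-row (y / M) (y % M) r<R (m%n<n y M))
    where
    eq : pos (y / M) (y % M) ≡ suc P + (Q + y)
    eq = trans (cong (base +_) (trans (+-comm _ (y % M)) (sym (m≡m%n+[m/n]*n y M)))) (arith P Q y)
      where
      arith : ∀ P Q y → P + suc Q + y ≡ suc P + (Q + y)
      arith = solve-∀
  ...         | no r≮R = past (≤-trans (≤-reflexive length-S) (≤-trans (+-monoʳ-≤ base y≥) (≤-reflexive (arith P Q y))))
    where
    arith : ∀ P Q y → P + suc Q + y ≡ suc P + (Q + y)
    arith = solve-∀
    y≥ : R * M + 0 ≤ y
    y≥ = ≤-trans (≤-reflexive (+-identityʳ (R * M))) (≤-trans (*-monoˡ-≤ M (≮⇒≥ r≮R))
           (≤-trans (m≤n+m _ (y % M)) (≤-reflexive (sym (m≡m%n+[m/n]*n y M)))))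

-- Substrings that occur only once

mark≢a : ∀ β → mark β ≢ a
mark≢a false ()
mark≢a true  ()

mark≢delim : ∀ β j → mark β ≢ delim (suc j)
mark≢delim false j ()
mark≢delim true  j ()

mark-injective : ∀ {β γ} → mark β ≡ mark γ → β ≡ γ
mark-injective {false} {false} _ = refl
mark-injective {true}  {true}  _ = refl

delim≢a : ∀ j → delim j ≢ a
delim≢a zero ()
delim≢a (suc j) ()

module Unique (P′ Q R′ : ℕ) (ω ζ : Bool) (R≤P′ : suc R′ ≤ P′) (R<Q : suc R′ < Q) where
  open Strings P′ Q R′ ω ζ R≤P′ R<Q

  1≤Q : 1 ≤ Q
  1≤Q = ≤-trans (s≤s z≤n) R<Q

  clash : ∀ {x c c′} → letter x ≡ c → letter x ≡ c′ → c ≢ c′ → ∀ {A : Set} → A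
  clash eq eq′ c≢c′ = contradiction (trans (sym eq) eq′) c≢c′

  copied : ∀ {q s e} → (∀ k → s + k ≤ e → letter (q + k) ≡ letter (s + k)) →
           ∀ k {x y c} → q + k ≡ x → s + k ≡ y → y ≤ e → letter y ≡ c → letter x ≡ c
  copied same k refl refl y≤e eq = trans (same k y≤e) eq

  -- A row is closed by the delimiter of the next row or by the default 0 past the end, so no run of
  -- a's or b's continues beyond it.
  row-end : ∀ j {c} → letter (pos j M) ≡ c → c ≢ a × c ≢ b
  row-end j refl with suc j <? R
  ... | yes j+1<R = (λ eq → clash (next eq) (at-d j+1<R) λ ()) , (λ eq → clash (next eq) (at-d j+1<R) λ ())
    where
    next : ∀ {c} → letter (pos j M) ≡ c → letter (pos (suc j) 0) ≡ c
    next = trans (cong (letter) (sym (pos-next j)))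
  ... | no j+1≮R = (λ eq → clash eq end λ ()) , (λ eq → clash eq end λ ())
    where
    end : letter (pos j M) ≡ 0
    end = letter-end (≤-trans (≤-reflexive length-S)
      (≤-trans (+-monoʳ-≤ base (+-monoˡ-≤ 0 (*-monoˡ-≤ M (≮⇒≥ j+1≮R)))) (≤-reflexive (sym (pos-next j)))))

  -- A later start within a^P runs into w. A start inside a row meets z after at most R letters, and
  -- `R≤P′` makes the run longer than that.
  a-run-unique : ¬ Recurs S 0 P′
  a-run-unique rec with recurs-letter rec
  ... | q , q≢0 , same = go (place q) q≢0 as
    where
    as : ∀ k → k ≤ P′ → letter (q + k) ≡ a
    as k k≤ = trans (same k k≤) (at-a (s≤s k≤))
    go : ∀ {q} → Place q → q ≢ 0 → (∀ k → k ≤ P′ → letter (q + k) ≡ a) → ∀ {A : Set} → A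
    go {zero}  (inA _) q≢0 as = contradiction refl q≢0
    go {suc q} (inA (s≤s q<P′)) q≢0 as with m≤n⇒∃[o]m+o≡n (<⇒≤ q<P′)
    ... | o , eq = clash (subst (λ x → letter x ≡ a) (cong suc eq) (as o (≤-trans (m≤n+m o q) (≤-reflexive eq)))) at-w (mark≢a ω ∘ sym)
    go (inRA j i j<R i≤j refl) q≢0 as with m≤n⇒∃[o]m+o≡n i≤j
    ... | o , refl = clash
      (subst (λ x → letter x ≡ a) (trans (pos-+ (i + o) (suc i) (suc o)) (cong (pos (i + o)) (cong suc (+-suc i o))))
        (as (suc o) (≤-trans (≤-trans (s≤s (m≤n+m o i)) j<R) R≤P′)))
      (at-rz j<R) (mark≢a ζ ∘ sym)
    go {q} p@(inW _) _ as = clash (trans (cong (letter) (+-identityʳ q)) (at-place p)) (as 0 z≤n) (mark≢a ω)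
    go {q} p@(inB _ _ _) _ as = clash (trans (cong (letter) (+-identityʳ q)) (at-place p)) (as 0 z≤n) (λ ())
    go {q} p@(inD j _ _) _ as = clash (trans (cong (letter) (+-identityʳ q)) (at-place p)) (as 0 z≤n) (delim≢a j)
    go {q} p@(inRZ _ _ _) _ as = clash (trans (cong (letter) (+-identityʳ q)) (at-place p)) (as 0 z≤n) (mark≢a ζ)
    go {q} p@(inRB _ _ _ _ _ _) _ as = clash (trans (cong (letter) (+-identityʳ q)) (at-place p)) (as 0 z≤n) (λ ())
    go {q} p@(past _) _ as = clash (trans (cong (letter) (+-identityʳ q)) (at-place p)) (as 0 z≤n) (λ ())

  -- An a is followed by an a, by w at the end of a^P, by z inside a row; `ω ≢ ζ` separates the last
  -- two.
  aw-unique : ω ≢ ζ → ∀ {x} → letter x ≡ a → letter (suc x) ≡ mark ω → suc x ≡ P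
  aw-unique ω≢ζ {x} x≡a sx≡w with place x
  ... | inA x<P with m≤n⇒m<n∨m≡n x<P
  ...   | inj₁ sx<P = clash sx≡w (at-a sx<P) (mark≢a ω)
  ...   | inj₂ eq   = eq
  aw-unique ω≢ζ x≡a sx≡w | inRA j i j<R i≤j refl with m≤n⇒m<n∨m≡n i≤j
  ...   | inj₁ i<j  = clash sx≡w (trans (cong (letter) (pos-suc j (suc i))) (at-ra j<R i<j)) (mark≢a ω)
  ...   | inj₂ refl = clash sx≡w (trans (cong (letter) (pos-suc j (suc i))) (at-rz j<R)) (ω≢ζ ∘ mark-injective)
  aw-unique _ x≡a _ | p@(inW _)             = clash (at-place p) x≡a (mark≢a ω)
  aw-unique _ x≡a _ | p@(inB _ _ _)         = clash (at-place p) x≡a (λ ())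
  aw-unique _ x≡a _ | p@(inD j _ _)         = clash (at-place p) x≡a (delim≢a j)
  aw-unique _ x≡a _ | p@(inRZ _ _ _)        = clash (at-place p) x≡a (mark≢a ζ)
  aw-unique _ x≡a _ | p@(inRB _ _ _ _ _ _)  = clash (at-place p) x≡a (λ ())
  aw-unique _ x≡a _ | p@(past _)            = clash (at-place p) x≡a (λ ())

  az-position : ω ≢ ζ → ∀ {x} → letter x ≡ a → letter (suc x) ≡ mark ζ → ∃ λ j → j < R × x ≡ pos j (suc j)
  az-position ω≢ζ {x} x≡a sx≡z with place x
  ... | inA x<P with m≤n⇒m<n∨m≡n x<P
  ...   | inj₁ sx<P = clash sx≡z (at-a sx<P) (mark≢a ζ)
  ...   | inj₂ refl = clash sx≡z at-w (ω≢ζ ∘ sym ∘ mark-injective)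
  az-position ω≢ζ x≡a sx≡z | inRA j i j<R i≤j refl with m≤n⇒m<n∨m≡n i≤j
  ...   | inj₁ i<j  = clash sx≡z (trans (cong (letter) (pos-suc j (suc i))) (at-ra j<R i<j)) (mark≢a ζ)
  ...   | inj₂ refl = j , j<R , refl
  az-position _ x≡a _ | p@(inW _)             = clash (at-place p) x≡a (mark≢a ω)
  az-position _ x≡a _ | p@(inB _ _ _)         = clash (at-place p) x≡a (λ ())
  az-position _ x≡a _ | p@(inD j _ _)         = clash (at-place p) x≡a (delim≢a j)
  az-position _ x≡a _ | p@(inRZ _ _ _)        = clash (at-place p) x≡a (mark≢a ζ)
  az-position _ x≡a _ | p@(inRB _ _ _ _ _ _)  = clash (at-place p) x≡a (λ ())
  az-position _ x≡a _ | p@(past _)            = clash (at-place p) x≡a (λ ())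

  -- Only the long b-run, which closes with the delimiter of row 0, has an a behind it; the b-runs
  -- of rows stop at `row-end`.
  ba-position : ∀ {x} → letter x ≡ b → letter (suc x) ≡ a → x ≡ pos 0 0
  ba-position {x} x≡b sx≡a with place x
  ... | inW refl = clash sx≡a (trans (cong (letter) (+-comm 1 P)) (at-b {0} z≤n)) (λ ())
  ... | inB k k<Q refl = clash sx≡a (trans (cong (letter) (sym (+-suc P (suc k)))) (at-b k<Q)) (λ ())
  ... | inD zero j<R eq = eq
  ... | p@(inD (suc j) _ _) = clash x≡b (at-place p) (λ ())
  ... | inRZ j j<R refl =
    clash sx≡a (trans (cong (letter) (pos-suc j (2 + j))) (at-rb j<R ≤-refl (s≤s (s≤s (s≤s j<R))))) (λ ())
  ... | inRB j c j<R j≤c c<M refl with m≤n⇒m<n∨m≡n c<M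
  ...   | inj₁ sc<M = clash sx≡a (trans (cong (letter) (pos-suc j c)) (at-rb j<R (m≤n⇒m≤1+n j≤c) sc<M)) (λ ())
  ...   | inj₂ refl = contradiction refl (proj₁ (row-end j (trans (cong (letter) (sym (pos-suc j c))) sx≡a)))
  ba-position x≡b _ | p@(inA _)           = clash (at-place p) x≡b (λ ())
  ba-position x≡b _ | p@(inRA _ _ _ _ _)  = clash (at-place p) x≡b (λ ())
  ba-position x≡b _ | p@(past _)          = clash (at-place p) x≡b (λ ())

  delim-position : ∀ {x} j → letter x ≡ delim (suc j) → x ≡ pos (suc j) 0
  delim-position {x} j eq with place x
  ... | p@(inA _)            = clash (at-place p) eq (λ ())
  ... | p@(inW _)            = clash (at-place p) eq (mark≢delim ω j)
  ... | p@(inB _ _ _)        = clash (at-place p) eq (λ ())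
  ... | p@(inD zero _ _)     = clash (at-place p) eq (λ ())
  ... | p@(inD (suc i) _ x≡) = trans x≡ (cong (λ t → pos (suc t) 0) (+-cancelˡ-≡ 4 i j (trans (sym (at-place p)) eq)))
  ... | p@(inRA _ _ _ _ _)   = clash (at-place p) eq (λ ())
  ... | p@(inRZ _ _ _)       = clash (at-place p) eq (mark≢delim ζ j)
  ... | p@(inRB _ _ _ _ _ _) = clash (at-place p) eq (λ ())
  ... | p@(past _)           = clash (at-place p) eq (λ ())

  w-position : ω ≡ true → ζ ≡ false → ∀ {x} → letter x ≡ mark ω → x ≡ P
  w-position refl refl {x} eq with place x
  ... | p@(inA _)            = clash (at-place p) eq (λ ())
  ... | inW x≡P              = x≡P
  ... | p@(inB _ _ _)        = clash (at-place p) eq (λ ())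
  ... | p@(inD zero _ _)     = clash (at-place p) eq (λ ())
  ... | p@(inD (suc i) _ _)  = clash (at-place p) eq (λ ())
  ... | p@(inRA _ _ _ _ _)   = clash (at-place p) eq (λ ())
  ... | p@(inRZ _ _ _)       = clash (at-place p) eq (λ ())
  ... | p@(inRB _ _ _ _ _ _) = clash (at-place p) eq (λ ())
  ... | p@(past _)           = clash (at-place p) eq (λ ())

  -- A row holds at most R + 1 consecutive b's, z included, and `R<Q` rules these out. The long run
  -- reaches from w or just behind it to the delimiter of row 0, which leaves room for these two
  -- starts only.
  b-run-position : ∀ {q} → (∀ k → k ≤ Q → letter (q + k) ≡ b) → q ≡ P ⊎ q ≡ suc P
  b-run-position {q} bs = go (place q)
    where
    q≡b : letter q ≡ b
    q≡b = trans (cong (letter) (sym (+-identityʳ q))) (bs 0 z≤n)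
    at-offset : ∀ k {x} → k ≤ Q → q + k ≡ x → letter x ≡ b
    at-offset k k≤Q refl = bs k k≤Q
    go : Place q → q ≡ P ⊎ q ≡ suc P
    go (inW q≡P) = inj₁ q≡P
    go (inB zero _ q≡) = inj₂ (trans q≡ (+-comm P 1))
    go (inB (suc k) k<Q refl) with m≤n⇒∃[o]m+o≡n (<⇒≤ (<⇒≤ k<Q))
    ... | o , eq = clash (at-offset o (≤-trans (m≤n+m o k) (≤-reflexive eq)) arith) (at-ra {0} {0} (s≤s z≤n) z≤n) (λ ())
      where
      arith : P + suc (suc k) + o ≡ pos 0 1
      arith = begin
        P + suc (suc k) + o    ≡⟨ lemma P k o ⟩
        P + suc (k + o) + 1    ≡⟨ cong (λ t → P + suc t + 1) eq ⟩
        pos 0 1                ∎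
        where
        open ≡-Reasoning
        lemma : ∀ P k o → P + suc (suc k) + o ≡ P + suc (k + o) + 1
        lemma = solve-∀
    go (inD zero j<R refl) =
      clash (at-offset 1 1≤Q (pos-+ 0 0 1)) (at-ra {0} {0} j<R z≤n) (λ ())
    go (inRZ j j<R refl) with m≤n⇒∃[o]m+o≡n (<⇒≤ j<R)
    ... | o , eq = contradiction refl (proj₂ (row-end j
          (at-offset (suc o) (≤-trans (s≤s (≤-trans (m≤n+m o j) (≤-reflexive eq))) R<Q)
            (trans (pos-+ j (2 + j) (suc o)) (cong (pos j) (trans (+-suc (2 + j) o) (cong (3 +_) eq)))))))
    go (inRB j c j<R j≤c c<M refl) with m≤n⇒∃[o]m+o≡n (<⇒≤ c<M)
    ... | o , eq = contradiction refl (proj₂ (row-end j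
          (at-offset o (<⇒≤ (≤-<-trans o≤R R<Q)) (trans (pos-+ j c o) (cong (pos j) eq)))))
      where
      o≤R : o ≤ R
      o≤R = +-cancelˡ-≤ 3 o R (≤-trans (+-monoˡ-≤ o (≤-trans (m≤m+n 3 j) j≤c)) (≤-reflexive eq))
    go p@(inA _)           = clash (at-place p) q≡b (λ ())
    go p@(inD (suc _) _ _) = clash (at-place p) q≡b (λ ())
    go p@(inRA _ _ _ _ _)  = clash (at-place p) q≡b (λ ())
    go p@(past _)          = clash (at-place p) q≡b (λ ())

  -- The pair az anchors a second occurrence at the az of some row i. If i < j, its longer a-run
  -- would cover the delimiter of row i; if i > j, its longer b-run would cover the position behind
  -- row i; and i = j is the same occurrence.
  piece-unique : ω ≢ ζ → ∀ {j} → j < R → ¬ Recurs S (pos j 1) (pos j (2 + R))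
  piece-unique ω≢ζ {j} j<R rec with recurs-letter rec
  ... | q , q≢ , same with az-position ω≢ζ {q + j} q+j≡a sq+j≡z
    where
    in-piece : ∀ {c} → c ≤ 2 + R → pos j c ≤ pos j (2 + R)
    in-piece c≤ = +-monoʳ-≤ base (+-monoʳ-≤ (j * M) c≤)
    q+j≡a : letter (q + j) ≡ a
    q+j≡a = copied same j refl (pos-+ j 1 j) (in-piece (s≤s (≤-trans (<⇒≤ j<R) (n≤1+n R)))) (at-ra j<R ≤-refl)
    sq+j≡z : letter (suc (q + j)) ≡ mark ζ
    sq+j≡z = copied same (suc j) (+-suc q j) (pos-+ j 1 (suc j)) (in-piece (s≤s (s≤s (<⇒≤ j<R)))) (at-rz j<R)
  ... | i , i<R , eq with <-cmp i j
  ... | tri≈ _ refl _ = q≢ (+-cancelʳ-≡ i q (pos i 1) (trans eq (sym (pos-+ i 1 i))))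
  ... | tri< i<j _ _ with m≤n⇒∃[o]m+o≡n i<j
  ...   | δ , refl = clash
          (copied same δ q+δ≡ (pos-+ (suc i + δ) 1 δ) (+-monoʳ-≤ base (+-monoʳ-≤ ((suc i + δ) * M) (s≤s (≤-trans (m≤n+m δ (suc i)) (≤-trans (<⇒≤ j<R) (n≤1+n R))))))
            (at-ra j<R (m≤n+m δ (suc i))))
          (at-d i<R) (delim≢a i ∘ sym)
    where
    q+δ≡ : q + δ ≡ pos i 0
    q+δ≡ = +-cancelʳ-≡ (suc i) (q + δ) (pos i 0) (trans (lemma q δ i) (trans eq (sym (pos-+ i 0 (suc i)))))
      where
      lemma : ∀ q δ i → q + δ + suc i ≡ q + (suc i + δ)
      lemma = solve-∀
  piece-unique ω≢ζ {j} j<R rec | q , q≢ , same | i , i<R , eq | tri> _ _ j<i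
    with m≤n⇒∃[o]m+o≡n j<i | m≤n⇒∃[o]m+o≡n (<⇒≤ i<R)
  ...   | δ , refl | o , i+o≡R = contradiction refl (proj₂ (row-end (suc j + δ)
          (copied same (j + (2 + o)) q+≡ (pos-+ j 1 (j + (2 + o))) (+-monoʳ-≤ base (+-monoʳ-≤ (j * M) c≤))
            (at-rb j<R (≤-trans (m≤m+n (3 + j) o) (≤-reflexive (lemma j o))) (s≤s c≤)))))
    where
    lemma : ∀ j o → 3 + j + o ≡ suc (j + (2 + o))
    lemma = solve-∀
    c≤ : suc (j + (2 + o)) ≤ 2 + R
    c≤ = ≤-trans (m≤m+n _ δ) (≤-trans (≤-reflexive (lemma′ j δ o)) (s≤s (s≤s (≤-reflexive i+o≡R))))
      where
      lemma′ : ∀ j δ o → suc (j + (2 + o)) + δ ≡ suc (suc (suc j + δ + o))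
      lemma′ = solve-∀
    q+≡ : q + (j + (2 + o)) ≡ pos (suc j + δ) M
    q+≡ = trans (sym (+-assoc q j (2 + o))) (trans (cong (_+ (2 + o)) eq) (trans (pos-+ (suc j + δ) (suc (suc j + δ)) (2 + o))
            (cong (pos (suc j + δ)) (trans (lemma″ (suc j + δ) o) (cong (3 +_) i+o≡R)))))
      where
      lemma″ : ∀ i o → suc i + (2 + o) ≡ 3 + (i + o)
      lemma″ = solve-∀

-- Counting forced phrase starts

cost : Bool → ℕ
cost false = 0
cost true  = 1

module Lower (P′ Q R′ : ℕ) (ω ζ : Bool) (R≤P′ : suc R′ ≤ P′) (R<Q : suc R′ < Q) where
  open Strings P′ Q R′ ω ζ R≤P′ R<Q
  open Unique P′ Q R′ ω ζ R≤P′ R<Q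

  bigram-unique : ∀ {s c c′} → letter s ≡ c → letter (suc s) ≡ c′ →
                  (∀ {x} → letter x ≡ c → letter (suc x) ≡ c′ → x ≡ s) → ¬ Recurs S s (suc s)
  bigram-unique {s} s≡c ss≡c′ unique rec with recurs-letter rec
  ... | q , q≢s , same = q≢s (unique
    (copied same 0 (+-identityʳ q) (+-identityʳ s) (n≤1+n s) s≡c)
    (copied same 1 (+-comm q 1) (+-comm s 1) ≤-refl ss≡c′))

  letter-unique : ∀ {s e} k {x c} → s + k ≡ x → x ≤ e → letter x ≡ c → (∀ {y} → letter y ≡ c → y ≡ x) → ¬ Recurs S s e
  letter-unique {s} k {x} s+k≡x x≤e x≡c unique rec with recurs-letter rec
  ... | q , q≢s , same = q≢s (+-cancelʳ-≡ k q s (trans (unique (copied same k refl s+k≡x x≤e x≡c)) (sym s+k≡x)))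

  -- The stretch has Q + 2 b's. Its only other possible start is `suc P`, and from there its last
  -- letter would be the first a of row 0.
  b-run-from-b : ω ≡ false → ¬ Recurs S P (pos 0 0)
  b-run-from-b refl rec with recurs-letter rec
  ... | q , q≢P , same with b-run-position (λ k k≤Q → copied same k refl refl (in-run k≤Q) (bs k k≤Q))
    where
    in-run : ∀ {k} → k ≤ Q → P + k ≤ pos 0 0
    in-run k≤Q = ≤-trans (+-monoʳ-≤ P (m≤n⇒m≤1+n k≤Q)) (m≤m+n base 0)
    bs : ∀ k → k ≤ Q → letter (P + k) ≡ b
    bs zero    k≤Q = trans (cong letter (+-identityʳ P)) at-w
    bs (suc k) k≤Q = at-b (<⇒≤ k≤Q)
  ...   | inj₁ q≡P = q≢P q≡P
  ...   | inj₂ refl = clash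
    (copied same (suc Q) (+-comm 1 base) (sym (+-identityʳ base)) ≤-refl (at-d (s≤s z≤n)))
    (at-ra {0} {0} (s≤s z≤n) z≤n) λ ()

  b-run-after-w : ω ≡ true → ¬ Recurs S (suc P) (pos 0 0)
  b-run-after-w refl rec with recurs-letter rec
  ... | q , q≢ , same with b-run-position bs
    where
    bs : ∀ k → k ≤ Q → letter (q + k) ≡ b
    bs k k≤Q = copied same k refl (sym (+-suc P k)) (≤-trans (+-monoʳ-≤ P (s≤s k≤Q)) (m≤m+n base 0)) (at-b k≤Q)
  ...   | inj₁ refl = clash
    (copied same 0 (+-identityʳ P) (sym (+-suc P 0)) (≤-trans (+-monoʳ-≤ P (s≤s z≤n)) (m≤m+n base 0)) (at-b z≤n))
    at-w λ ()
  ...   | inj₂ q≡ = q≢ q≡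

  pos<length : ∀ {j c} → j < R → c < M → pos j c < length S
  pos<length {j} {c} j<R c<M = <-≤-trans (+-monoʳ-< base (+-monoʳ-< (j * M) c<M))
    (≤-trans (≤-reflexive (pos-next j))
    (≤-trans (+-monoʳ-≤ base (+-monoˡ-≤ 0 (*-monoˡ-≤ M j<R))) (≤-reflexive (sym length-S))))

  pos-mono-< : ∀ j {c c′} → c < c′ → pos j c < pos j c′
  pos-mono-< j c<c′ = +-monoʳ-< base (+-monoʳ-< (j * M) c<c′)

  head<length : ∀ {x} → x ≤ base → x < length S
  head<length x≤ = ≤-<-trans (≤-trans x≤ (m≤m+n base 0)) (pos<length {0} {0} (s≤s z≤n) (s≤s z≤n))

  module _ (fs : List Phrase) (valid : ValidScheme S fs) where
    N : ℕ → ℕ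
    N = startsUpTo 0 fs

    cut : ∀ {s e k} → s < e → e < length S → ¬ Recurs S s e → k ≤ N s → suc k ≤ N e
    cut s<e e< unique k≤ = ≤-trans (s≤s k≤) (unique-cut {S} fs valid s<e e< unique)

    N-positive : ∀ {x} → x < length S → 1 ≤ N x
    N-positive x< = starts-positive fs z≤n (<-≤-trans x< (≤-reflexive (sym (proj₁ valid))))

    -- One start at 0, one in the rest of a^P, and one exactly at w, the only position in (P′, P].
    through-aw : ω ≢ ζ → 3 ≤ N P
    through-aw ω≢ζ =
      cut ≤-refl (head<length (m≤m+n P (suc Q)))
        (bigram-unique (at-a ≤-refl) at-w (λ x≡a sx≡w → suc-injective (aw-unique ω≢ζ x≡a sx≡w)))
      (cut (<-≤-trans (s≤s z≤n) R≤P′) (head<length (≤-trans (n≤1+n P′) (m≤m+n P (suc Q)))) a-run-unique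
      (N-positive (head<length z≤n)))

    -- If w = b, the run from w to the delimiter of row 0 adds one start. If w ≠ b, the unique
    -- letter w also forces a start right behind it, which is the `cost`.
    through-head : ∀ α β → ω ≡ α → ζ ≡ β → α ≢ β → 4 + cost α ≤ N (pos 0 0)
    through-head false false _ _ α≢β = contradiction refl α≢β
    through-head true  true  _ _ α≢β = contradiction refl α≢β
    through-head false true refl refl α≢β =
      cut (≤-trans (≤-trans (≤-reflexive (+-comm 1 P)) (+-monoʳ-≤ P (s≤s z≤n))) (m≤m+n base 0))
        (pos<length {0} {0} (s≤s z≤n) (s≤s z≤n)) (b-run-from-b refl)
      (through-aw α≢β)
    through-head true false refl refl α≢β =
      cut (≤-trans (≤-trans (≤-reflexive (+-comm 2 P)) (+-monoʳ-≤ P (s≤s 1≤Q))) (m≤m+n base 0))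
        (pos<length {0} {0} (s≤s z≤n) (s≤s z≤n)) (b-run-after-w refl)
      (cut ≤-refl (head<length (≤-trans (≤-reflexive (+-comm 1 P)) (+-monoʳ-≤ P (s≤s z≤n))))
        (letter-unique 0 (+-identityʳ P) (n≤1+n P) at-w (w-position refl refl))
      (through-aw α≢β))

    through-piece : ω ≢ ζ → ∀ {j k} → j < R → k ≤ N (pos j 1) → suc k ≤ N (pos j (2 + R))
    through-piece ω≢ζ {j} j<R = cut (pos-mono-< j (s≤s (s≤s z≤n))) (pos<length j<R ≤-refl) (piece-unique ω≢ζ j<R)

    -- The pair that ends in the delimiter and the pair that begins with it both contain a letter
    -- occurring once, so the delimiter is a phrase by itself.
    through-delim : ∀ {j k} → suc j < R → k ≤ N (pos j (2 + R)) → 2 + k ≤ N (pos (suc j) 1)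
    through-delim {j} j<R k≤ =
      cut (pos-mono-< (suc j) (s≤s z≤n)) (pos<length j<R (s≤s (s≤s z≤n)))
        (letter-unique 0 (+-identityʳ _) (<⇒≤ (pos-mono-< (suc j) (s≤s z≤n))) (at-d j<R) (delim-position j))
      (cut (≤-reflexive next) (pos<length j<R (s≤s z≤n))
        (letter-unique 1 (trans (+-comm _ 1) next) ≤-refl (at-d j<R) (delim-position j))
      k≤)
      where
      next : suc (pos j (2 + R)) ≡ pos (suc j) 0
      next = trans (pos-suc j (2 + R)) (pos-next j)

    through-row : ω ≢ ζ → ∀ j {k} → j < R → k ≤ N (pos 0 0) → j * 3 + (2 + k) ≤ N (pos j (2 + R))
    through-row ω≢ζ zero j<R k≤ = through-piece ω≢ζ j<R
      -- The delimiter of row 0 is not a unique letter; the unique pair ba takes over and forces a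
      -- start at the first a of the row.
      (cut (pos-mono-< 0 (s≤s z≤n)) (pos<length j<R (s≤s (s≤s z≤n)))
        (subst (λ t → ¬ Recurs S (pos 0 0) t) (pos-suc 0 0)
          (bigram-unique (at-d j<R) (trans (cong letter (pos-suc 0 0)) (at-ra j<R z≤n)) ba-position))
      k≤)
    through-row ω≢ζ (suc j) j<R k≤ =
      through-piece ω≢ζ j<R (through-delim j<R (through-row ω≢ζ j (<⇒≤ j<R) k≤))

    lower : ω ≢ ζ → R′ * 3 + (6 + cost ω) ≤ length fs
    lower ω≢ζ = ≤-trans (through-row ω≢ζ R′ ≤-refl (through-head ω ζ refl refl ω≢ζ)) (starts≤length 0 fs _)

    -- When w = z the pieces do recur; the delimiters alone then show that b(T) grows with R.
    through-delims : ∀ j → j < R → suc j ≤ N (pos j 0)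
    through-delims zero    j<R = N-positive (pos<length j<R (s≤s z≤n))
    through-delims (suc j) j<R =
      cut (<-≤-trans (pos-mono-< j (s≤s z≤n)) (≤-reflexive (pos-next j))) (pos<length j<R (s≤s z≤n))
        (letter-unique M (trans (pos-+ j 0 M) (pos-next j)) ≤-refl (at-d j<R) (delim-position j))
      (through-delims j (<⇒≤ j<R))

    R≤schemes : R ≤ length fs
    R≤schemes = ≤-trans (through-delims R′ ≤-refl) (starts≤length 0 fs _)

-- A small scheme when w = z

module Upper (P′ Q R′ : ℕ) (ω : Bool) (R≤P′ : suc R′ ≤ P′) (R<Q : suc R′ < Q) where
  open Strings P′ Q R′ ω ω R≤P′ R<Q
  open Unique P′ Q R′ ω ω R≤P′ R<Q using (1≤Q)

  -- The source of row j starts j + 1 letters before w, so that its z falls on w; sources are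
  -- 1-indexed.
  rowPhrases : ℕ → ℕ → List Phrase
  rowPhrases j zero    = copy (2 + R) (suc (P′ ∸ j)) ∷ []
  rowPhrases j (suc k) = copy (2 + R) (suc (P′ ∸ j)) ∷ ground ∷ rowPhrases (suc j) k

  -- Each long run is copied from one position to its left, overlapping its own source. The b-run,
  -- up to the delimiter of row 0, grows from w if w = b and otherwise from an extra ground b.
  headPhrases : Bool → List Phrase → List Phrase
  headPhrases false fs = ground ∷ copy P′ 1 ∷ ground ∷ copy (suc Q) (suc P) ∷ fs
  headPhrases true  fs = ground ∷ copy P′ 1 ∷ ground ∷ ground ∷ copy Q (suc (suc P)) ∷ fs

  scheme : Bool → List Phrase
  scheme β = headPhrases β (rowPhrases 0 R′)

  piece-copy : ∀ {j} → j < R → LeftPhrase S (pos j 1) (copy (2 + R) (suc (P′ ∸ j)))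
  piece-copy {j} j<R = s≤s z≤n , P′ ∸ j , refl ,
    ≤-<-trans (m∸n≤m P′ j) (≤-<-trans (≤-trans (n≤1+n P′) (m≤m+n P (suc Q))) (m<m+n base (≤-trans (s≤s z≤n) (m≤n+m 1 (j * M))))) ,
    λ k k< → letter-at (trans (same k k<) (cong letter (sym (pos-+ j 1 k))))
    where
    j≤P′ : j ≤ P′
    j≤P′ = ≤-trans (<⇒≤ j<R) R≤P′
    same : ∀ k → k < 2 + R → letter (P′ ∸ j + k) ≡ letter (pos j (suc k))
    same k k< with <-cmp k (suc j)
    ... | tri< k≤j _ _ = trans
      (at-a (s≤s (≤-trans (+-monoʳ-≤ (P′ ∸ j) (≤-pred k≤j)) (≤-reflexive (m∸n+n≡m j≤P′)))))
      (sym (at-ra j<R (≤-pred k≤j)))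
    ... | tri≈ _ refl _ = trans
      (trans (cong letter (trans (+-suc (P′ ∸ j) j) (cong suc (m∸n+n≡m j≤P′)))) at-w)
      (sym (at-rz j<R))
    ... | tri> _ _ j<k with m≤n⇒∃[o]m+o≡n j<k
    ...   | i , refl = trans
      (trans (cong letter (trans (arith (P′ ∸ j) j i) (cong (λ t → suc t + suc i) (m∸n+n≡m j≤P′))))
             (at-b (≤-trans (≤-trans (m≤n+m i j) (<⇒≤ (≤-pred (≤-pred k<)))) (<⇒≤ R<Q))))
      (sym (at-rb j<R (s≤s (s≤s (s≤s (m≤m+n j i)))) (s≤s k<)))
      where
      arith : ∀ p j i → p + (2 + j + i) ≡ suc (p + j) + suc i
      arith = solve-∀

  rows-left : ∀ j k → j + k ≡ R′ → LeftScheme S (pos j 1) (rowPhrases j k)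
  rows-left j zero eq = piece-copy j<R , (begin
      pos j 1 + (2 + R)  ≡⟨ pos-+ j 1 (2 + R) ⟩
      pos j M            ≡⟨ pos-next j ⟩
      pos (suc j) 0      ≡⟨ cong (λ t → pos (suc t) 0) (trans (sym (+-identityʳ j)) eq) ⟩
      pos R 0            ≡⟨ sym length-S ⟩
      length S           ∎)
    where
    open ≡-Reasoning
    j<R : j < R
    j<R = s≤s (≤-trans (m≤m+n j 0) (≤-reflexive eq))
  rows-left j (suc k) eq = piece-copy (s≤s (≤-trans (m≤m+n j (suc k)) (≤-reflexive eq))) , tt ,
    subst (λ p → LeftScheme S p (rowPhrases (suc j) k)) (sym next)
      (rows-left (suc j) k (trans (sym (+-suc j k)) eq))
    where
    next : pos j 1 + (2 + R) + 1 ≡ pos (suc j) 1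
    next = trans (cong (_+ 1) (trans (pos-+ j 1 (2 + R)) (pos-next j))) (pos-+ (suc j) 0 1)

  a-copy : LeftPhrase S 1 (copy P′ 1)
  a-copy = ≤-trans (s≤s z≤n) R≤P′ , 0 , refl , s≤s z≤n ,
    λ k k< → letter-at (trans (at-a (m≤n⇒m≤1+n k<)) (sym (at-a (s≤s k<))))

  head-left : ∀ β fs → ω ≡ β → LeftScheme S (pos 0 1) fs → LeftScheme S 0 (headPhrases β fs)
  head-left false fs refl ok = tt , a-copy , tt ,
    (s≤s z≤n , P , refl , m<m+n P (s≤s z≤n) ,
      λ k k< → letter-at (trans (bs k (≤-pred k<)) (sym (trans (cong letter (+-assoc P 1 k)) (at-b (≤-pred k<)))))) ,
    subst (λ p → LeftScheme S p fs) (arith P Q) ok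
    where
    bs : ∀ k → k ≤ Q → letter (P + k) ≡ b
    bs zero    k≤Q = trans (cong letter (+-identityʳ P)) at-w
    bs (suc k) k≤Q = at-b (<⇒≤ k≤Q)
    arith : ∀ P Q → P + suc Q + 1 ≡ P + 1 + suc Q
    arith = solve-∀
  head-left true fs refl ok = tt , a-copy , tt , tt ,
    (1≤Q , suc P , refl , ≤-reflexive (arith₂ P) ,
      λ k k< → letter-at (trans (trans (cong letter (sym (+-suc P k))) (at-b (<⇒≤ k<))) (sym (trans (cong letter (arith₁ P k)) (at-b k<))))) ,
    subst (λ p → LeftScheme S p fs) (arith P Q) ok
    where
    arith : ∀ P Q → P + suc Q + 1 ≡ P + 1 + 1 + Q
    arith = solve-∀
    arith₁ : ∀ P k → P + 1 + 1 + k ≡ P + suc (suc k)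
    arith₁ = solve-∀
    arith₂ : ∀ P → suc (suc P) ≡ P + 1 + 1
    arith₂ = solve-∀

  scheme-valid : ValidScheme S (scheme ω)
  scheme-valid = left-valid S (scheme ω) (head-left ω _ refl (rows-left 0 R′ refl))

  length-rowPhrases : ∀ j k → length (rowPhrases j k) ≡ suc (k * 2)
  length-rowPhrases j zero    = refl
  length-rowPhrases j (suc k) = cong (2 +_) (length-rowPhrases (suc j) k)

  length-scheme : ∀ β → length (scheme β) ≡ 5 + cost β + R′ * 2
  length-scheme false = cong (4 +_) (length-rowPhrases 0 R′)
  length-scheme true  = cong (5 +_) (length-rowPhrases 0 R′)

-- Comparing the two bounds

length-string : ∀ P′ Q R′ ω ζ → suc R′ ≤ P′ → suc R′ < Q →
                length (string (suc P′) Q (suc R′) ω ζ) ≡ suc P′ + suc Q + suc R′ * (4 + R′)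
length-string P′ Q R′ ω ζ R≤P′ R<Q =
  trans (Strings.length-S P′ Q R′ ω ζ R≤P′ R<Q) (cong (suc P′ + suc Q +_) (+-identityʳ _))

matched-b : ∀ P′ Q R′ ω → suc R′ ≤ P′ → suc R′ < Q →
            ∃ λ k → IsB (string (suc P′) Q (suc R′) ω ω) k × suc R′ ≤ k × k ≤ 5 + cost ω + R′ * 2
matched-b P′ Q R′ ω R≤P′ R<Q with b-exists (string (suc P′) Q (suc R′) ω ω)
... | k , ((fs , valid , refl) , least-k) = k , ((fs , valid , refl) , least-k) ,
  Lower.R≤schemes P′ Q R′ ω ω R≤P′ R<Q fs valid ,
  ≤-trans (least-k _ scheme-valid) (≤-reflexive (length-scheme ω))
  where open Upper P′ Q R′ ω R≤P′ R<Q

unmatched-b : ∀ P′ Q R′ {ω ζ} → suc R′ ≤ P′ → suc R′ < Q → ω ≢ ζ →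
              ∃ λ k → IsB (string (suc P′) Q (suc R′) ω ζ) k × R′ * 3 + (6 + cost ω) ≤ k
unmatched-b P′ Q R′ {ω} {ζ} R≤P′ R<Q ω≢ζ with b-exists (string (suc P′) Q (suc R′) ω ζ)
... | k , ((fs , valid , refl) , least-k) = k , ((fs , valid , refl) , least-k) ,
  Lower.lower P′ Q R′ ω ζ R≤P′ R<Q fs valid ω≢ζ

cost≤1 : ∀ β → cost β ≤ 1
cost≤1 false = z≤n
cost≤1 true  = ≤-refl

-- The contributions of the rows cancel, 3 · 2 against 2 · 3. What remains is 3 (5 + c) - 2 (6 + c′)
-- = 3 + 3 c - 2 c′, which `slack` bounds by `s`.
ratio-bound : ∀ N c c′ s {x y} → 3 + 3 * c ≤ 2 * c′ + s →
              x ≤ 5 + c + suc N * 2 → suc N * 3 + (6 + c′) ≤ y → 3 * x ≤ 2 * y + s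
ratio-bound N c c′ s {x} {y} slack x≤ ≤y = begin
  3 * x                                ≤⟨ *-monoʳ-≤ 3 x≤ ⟩
  3 * (5 + c + suc N * 2)              ≡⟨ lhs c N ⟩
  12 + suc N * 6 + (3 + 3 * c)         ≤⟨ +-monoʳ-≤ (12 + suc N * 6) slack ⟩
  12 + suc N * 6 + (2 * c′ + s)        ≡⟨ rhs c′ N s ⟩
  2 * (suc N * 3 + (6 + c′)) + s       ≤⟨ +-monoˡ-≤ s (*-monoʳ-≤ 2 ≤y) ⟩
  2 * y + s                            ∎
  where
  open ≤-Reasoning
  lhs : ∀ c N → 3 * (5 + c + suc N * 2) ≡ 12 + suc N * 6 + (3 + 3 * c)
  lhs = solve-∀
  rhs : ∀ c N s → 12 + suc N * 6 + (2 * c + s) ≡ 2 * (suc N * 3 + (6 + c)) + s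
  rhs = solve-∀

gap-bound : ∀ N {c} c′ {x y} → c ≤ 1 → x ≤ 5 + c + suc N * 2 → suc N * 3 + (6 + c′) ≤ y → suc N ≤ y ∸ x
gap-bound N {c} c′ {x} {y} c≤1 x≤ ≤y = m+n≤o⇒m≤o∸n (suc N) (begin
  suc N + x                           ≤⟨ +-monoʳ-≤ (suc N) x≤ ⟩
  suc N + (5 + c + suc N * 2)         ≤⟨ +-monoʳ-≤ (suc N) (+-monoˡ-≤ (suc N * 2) (+-monoʳ-≤ 5 c≤1)) ⟩
  suc N + (6 + suc N * 2)             ≡⟨ arith N ⟩
  suc N * 3 + 6                       ≤⟨ +-monoʳ-≤ (suc N * 3) (m≤m+n 6 c′) ⟩
  suc N * 3 + (6 + c′)                ≤⟨ ≤y ⟩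
  y                                   ∎)
  where
  open ≤-Reasoning
  arith : ∀ N → suc N + (6 + suc N * 2) ≡ suc N * 3 + 6
  arith = solve-∀

-- The factor 5 is the least that survives N = 0, where the length can be 18 and the gap 1.
square-bound : ∀ N {q g} → q ≤ 4 + N → suc N ≤ g → 3 + N + suc q + (2 + N) * (5 + N) ≤ (5 * g) ^ 2
square-bound N {q} {g} q≤ N<g = begin
  3 + N + suc q + (2 + N) * (5 + N)                ≤⟨ +-monoˡ-≤ ((2 + N) * (5 + N)) (+-monoʳ-≤ (3 + N) (s≤s q≤)) ⟩
  3 + N + suc (4 + N) + (2 + N) * (5 + N)          ≤⟨ m≤m+n _ (24 * (N * N) + 41 * N + 7) ⟩
  3 + N + suc (4 + N) + (2 + N) * (5 + N) + (24 * (N * N) + 41 * N + 7)  ≡⟨ arith N ⟩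
  (5 * suc N) * ((5 * suc N) * 1)                  ≤⟨ ^-monoˡ-≤ 2 (*-monoʳ-≤ 5 N<g) ⟩
  (5 * g) ^ 2                                      ∎
  where
  open ≤-Reasoning
  arith : ∀ N → 3 + N + suc (4 + N) + (2 + N) * (5 + N) + (24 * (N * N) + 41 * N + 7) ≡ (5 * suc N) * ((5 * suc N) * 1)
  arith = solve-∀

additive-witness : ∀ (lenT′ : ℕ → ℕ) s N c c′ q T T′ → c ≤ 1 → 3 + 3 * c ≤ 2 * c′ + s → q ≤ 4 + N →
  length T ≡ 3 + N + suc q + (2 + N) * (5 + N) → length T′ ≡ lenT′ (length T) × ed T T′ ≡ 1 →
  (∃ λ k → IsB T k × 2 + N ≤ k × k ≤ 5 + c + suc N * 2) →
  (∃ λ k → IsB T′ k × suc N * 3 + (6 + c′) ≤ k) →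
  Σ Str λ U → Σ Str λ U′ → Σ ℕ λ bU → Σ ℕ λ bU′ →
    N ≤ length U × N ≤ bU × length U′ ≡ lenT′ (length U) × ed U U′ ≡ 1 × IsB U bU × IsB U′ bU′ ×
    3 * bU ≤ 2 * bU′ + s × length U ≤ (5 * (bU′ ∸ bU)) ^ 2
additive-witness lenT′ s N c c′ q T T′ c≤1 slack q≤ length≡ (length′ , ed1) (bT , isB , ≤bT , bT≤) (bT′ , isB′ , ≤bT′) =
  T , T′ , bT , bT′ ,
  ≤-trans (≤-trans (m≤n+m N 3) (≤-trans (m≤m+n (3 + N) (suc q)) (m≤m+n _ ((2 + N) * (5 + N))))) (≤-reflexive (sym length≡)) ,
  m+n≤o⇒n≤o 2 ≤bT , length′ , ed1 , isB , isB′ ,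
  ratio-bound N c c′ s slack bT≤ ≤bT′ ,
  ≤-trans (≤-reflexive length≡) (square-bound N q≤ (gap-bound N c′ c≤1 bT≤ ≤bT′))

additive : ∀ (lenT′ : ℕ → ℕ) s ω ω′ (Q Q′ : ℕ → ℕ) → ω′ ≢ ω → 3 + 3 * cost ω ≤ 2 * cost ω′ + s →
           (∀ R → Q R ≤ 2 + R) → (∀ R → R < Q R) → (∀ R → R < Q′ R) →
           (∀ R → length (string (suc R) (Q′ R) R ω′ ω) ≡ lenT′ (length (string (suc R) (Q R) R ω ω)) ×
                  ed (string (suc R) (Q R) R ω ω) (string (suc R) (Q′ R) R ω′ ω) ≡ 1) →
           ASLowerBound lenT′ s
-- The gap is only bounded below by R - 1, so R starts at 2 to keep it positive for N = 0.
additive lenT′ s ω ω′ Q Q′ ω′≢ω slack Q≤ R<Q R<Q′ edit = 5 , λ N → let R = 2 + N in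
  additive-witness lenT′ s N (cost ω) (cost ω′) (Q R) (string (suc R) (Q R) R ω ω) (string (suc R) (Q′ R) R ω′ ω)
    (cost≤1 ω) slack (Q≤ R) (length-string R (Q R) (suc N) ω ω ≤-refl (R<Q R)) (edit R)
    (matched-b R (Q R) (suc N) ω ≤-refl (R<Q R))
    (unmatched-b R (Q′ R) (suc N) {ω′} {ω} ≤-refl (R<Q′ R) ω′≢ω)

-- The three edits

tail-string : ℕ → ℕ → Bool → Str
tail-string Q R ζ = replicate Q b ++ rows (mark ζ) 0 R

length-middle : ∀ (us : Str) x y zs → length (us ++ x ∷ zs) ≡ length (us ++ y ∷ zs)
length-middle us x y zs = trans (length-++ us) (sym (length-++ us))

length-insert : ∀ (us : Str) y zs → length (us ++ y ∷ zs) ≡ suc (length (us ++ zs))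
length-insert us y zs = trans (length-++ us) (trans (+-suc _ _) (cong suc (sym (length-++ us))))

substitution : ASLowerBound (λ n → n) 2
substitution = additive (λ n → n) 2 false true suc suc (λ ()) (n≤1+n 3) (λ R → n≤1+n (suc R)) (λ R → ≤-refl) (λ R → ≤-refl)
  λ R → let us = replicate (suc R) a; zs = tail-string (suc R) R false in
  length-middle us 3 b zs , ed≡1 us (b ∷ zs) (3 ∷ zs) (λ ()) (ed-substitute b 3 zs)

-- The b that stood in the place of w joins b^Q behind the new letter, so Q grows by one.
insertion : ASLowerBound suc 2
insertion = additive suc 2 false true suc (2 +_) (λ ()) (n≤1+n 3) (λ R → n≤1+n (suc R)) (λ R → ≤-refl) (λ R → n≤1+n (suc R))
  λ R → let us = replicate (suc R) a; zs = b ∷ tail-string (suc R) R false in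
  length-insert us 3 zs , ed≡1 us zs (3 ∷ zs) (λ ()) (ed-insert 3 zs)

delete-w : ∀ P Q R → (let T = string P (suc Q) R true true; T′ = string P Q R false true) →
           length T′ ≡ length T ∸ 1 × ed T T′ ≡ 1
delete-w P Q R = sym (cong (_∸ 1) (length-insert us 3 zs)) , ed≡1 us (3 ∷ zs) zs (λ ()) (ed-delete 3 zs)
  where
  us zs : Str
  us = replicate P a
  zs = b ∷ tail-string Q R true

-- The extra phrase for w ≠ b now falls on T and not on T′, so the slack condition is the equality 3
-- + 3 = 6.
deletion : ASLowerBound (λ n → n ∸ 1) 6
deletion = additive (λ n → n ∸ 1) 6 true false (2 +_) suc (λ ()) ≤-refl (λ R → ≤-refl) (λ R → n≤1+n (suc R)) (λ R → ≤-refl)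
  λ R → delete-w (suc R) (suc R) R

-- With K = `suc k` and R′ rows after the first, the bounds give a difference of 4 R′ - 6 K + 12.
-- The choice R′ = 2 K makes it 2 K + 12, the added `14 + 2 * k`.
liminf-ratio : ∀ k {x y} → x ≤ 6 + 2 * suc k * 2 → 2 * suc k * 3 + 6 ≤ y → (3 * suc k ∸ 2) * x < 2 * suc k * y
liminf-ratio k {x} {y} x≤ ≤y = begin-strict
  (3 * suc k ∸ 2) * x                               ≡⟨ cong (_* x) (trans (cong (_∸ 2) (factor k)) (m+n∸m≡n 2 (1 + 3 * k))) ⟩
  (1 + 3 * k) * x                                   ≤⟨ *-monoʳ-≤ (1 + 3 * k) x≤ ⟩
  (1 + 3 * k) * (6 + 2 * suc k * 2)                 <⟨ m<m+n _ {14 + 2 * k} (s≤s z≤n) ⟩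
  (1 + 3 * k) * (6 + 2 * suc k * 2) + (14 + 2 * k)  ≡⟨ arith k ⟩
  2 * suc k * (2 * suc k * 3 + 6)                   ≤⟨ *-monoʳ-≤ (2 * suc k) ≤y ⟩
  2 * suc k * y                                     ∎
  where
  open ≤-Reasoning
  factor : ∀ k → 3 * suc k ≡ 2 + (1 + 3 * k)
  factor = solve-∀
  arith : ∀ k → (1 + 3 * k) * (6 + 2 * suc k * 2) + (14 + 2 * k) ≡ 2 * suc k * (2 * suc k * 3 + 6)
  arith = solve-∀

liminf-witness : ∀ k n T T′ → length T ≡ n → length T′ ≡ length T ∸ 1 × ed T T′ ≡ 1 →
  (∃ λ b → IsB T b × suc (2 * suc k) ≤ b × b ≤ 6 + 2 * suc k * 2) →
  (∃ λ b → IsB T′ b × 2 * suc k * 3 + 6 ≤ b) →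
  Σ Str λ T → Σ Str λ T′ → Σ ℕ λ bT → Σ ℕ λ bT′ →
    length T ≡ n × length T′ ≡ n ∸ 1 × ed T T′ ≡ 1 × IsB T bT × IsB T′ bT′ ×
    (3 * suc k ∸ 2) * bT < 2 * suc k * bT′
liminf-witness k n T T′ refl (length′ , ed1) (bT , isB , _ , bT≤) (bT′ , isB′ , ≤bT′) =
  T , T′ , bT , bT′ , refl , length′ , ed1 , isB , isB′ , liminf-ratio k bT≤ ≤bT′

-- Only the leading a-run depends on n, so the ratio is reached at every large length.
liminf-deletion : LiminfMSDel
liminf-deletion (suc k) _ = threshold , λ n N≤n → padded n (m≤n⇒∃[o]m+o≡n N≤n)
  where
  R′ R threshold : ℕ
  R′ = 2 * suc k
  R  = suc R′
  threshold = suc R + (3 + R) + R * (4 + R′)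
  padded-length : ∀ R R′ o → suc (R + o) + (3 + R) + R * (4 + R′) ≡ suc R + (3 + R) + R * (4 + R′) + o
  padded-length = solve-∀
  padded : ∀ n → (∃ λ o → threshold + o ≡ n) → _
  padded n (o , eq) = liminf-witness k n
    (string (suc (R + o)) (2 + R) R true true) (string (suc (R + o)) (suc R) R false true)
    (trans (length-string (R + o) (2 + R) R′ true true (m≤m+n R o) (n≤1+n (suc R))) (trans (padded-length R R′ o) eq))
    (delete-w (suc (R + o)) (suc R) R)
    (matched-b (R + o) (2 + R) R′ true (m≤m+n R o) (n≤1+n (suc R)))
    (unmatched-b (R + o) (suc R) R′ {false} {true} (m≤m+n R o) ≤-refl (λ ()))

theorem10 : ASLowerBound (λ n → n) 2 × ASLowerBound suc 2 × (LiminfMSDel × ASLowerBound (λ n → n ∸ 1) 6)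
theorem10 = substitution , insertion , liminf-deletion , deletion
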